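{- Let $\mathcal{N}$ be a near hexagon of order $(2,2)$ which contains a subgeometry isomorphic to the generalized hexagon $\mathrm{H}(2,1)$ that is isometrically embedded in $\mathcal{N}$. Then $\mathcal{N}$ is isomorphic to the dual split Cayley hexagon $\mathrm{H}(2)^D$.
   Context: A partial linear space has order $(s,t)$ if every line has exactly $s+1$ points and every point is on exactly $t+1$ lines. Distances are measured in the collinearity graph. A near $2d$-gon is a partial linear space whose collinearity graph is connected of diameter $d$ and such that for every point $x$ and every line $L$ there is a unique point on $L$ nearest to $x$; a near hexagon is a near $6$-gon. A subgeometry $\mathcal{S}=(\mathcal{P},\mathcal{L})$ of $\mathcal{N}=(\mathcal{P}',\mathcal{L}')$ (with $\mathcal{P}\subseteq\mathcal{P}'$, $\mathcal{L}\subseteq\mathcal{L}'$ and induced incidence) is isometrically embedded if distances between points of $\mathcal{P}$ in $\mathcal{S}$ and in $\mathcal{N}$ coincide. $\mathrm{H}(2,1)$ is the unique generalized hexagon of order $(2,1)$ (the point-line dual of the incidence graph of the Fano plane). $\mathrm{H}(2)^D$ is the point-line dual of the split Cayley hexagon $\mathrm{H}(2)$ of order $(2,2)$. -}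

module Defs where

open import Data.Bool using (Bool; true; false; T; _∧_; _∨_; not; _xor_)
open import Data.Nat using (ℕ; zero; suc; _+_; _∸_; _≡ᵇ_; _%_)
open import Data.Fin using (Fin; toℕ; #_)
open import Data.Vec using (Vec; []; _∷_; lookup)
open import Data.Product using (Σ; ∃; _×_; _,_; proj₁; proj₂)
open import Data.Sum using (_⊎_; inj₁; inj₂)
open import Relation.Binary.PropositionalEquality using (_≡_; _≢_)
open import Relation.Nullary using (¬_)
open import Function.Bundles using (_⤖_; _⇔_; Bijection)

-- Point-line geometries.  Incidence is Bool-valued (so that the set of
-- points on a line, the set of lines through a point and subsets of
-- points/lines are proof-irrelevant).

record Geom : Set₁ where
  field
    Pt  : Set
    Ln  : Set
    inc : Pt → Ln → Bool
open Geom public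

record _≅_ (G H : Geom) : Set where
  field
    ptBij : Pt G ⤖ Pt H
    lnBij : Ln G ⤖ Ln H
    pres  : ∀ p L → inc G p L ≡ inc H (Bijection.to ptBij p) (Bijection.to lnBij L)

module _ (G : Geom) where

  PtsOn : Ln G → Set
  PtsOn L = Σ (Pt G) (λ p → T (inc G p L))

  LnsThrough : Pt G → Set
  LnsThrough p = Σ (Ln G) (λ L → T (inc G p L))

  IsPartialLinearSpace : Set
  IsPartialLinearSpace =
    (∀ L → Σ (Pt G) λ p → Σ (Pt G) λ q → p ≢ q × T (inc G p L) × T (inc G q L))
    × (∀ p q L M → p ≢ q → T (inc G p L) → T (inc G q L)
                         → T (inc G p M) → T (inc G q M) → L ≡ M)

  HasOrder : ℕ → ℕ → Set
  HasOrder s t = (∀ L → Fin (suc s) ⤖ PtsOn L) × (∀ p → Fin (suc t) ⤖ LnsThrough p)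

  Collinear : Pt G → Pt G → Set
  Collinear x y = x ≢ y × Σ (Ln G) (λ L → T (inc G x L) × T (inc G y L))

  Within : ℕ → Pt G → Pt G → Set
  Within zero    x y = x ≡ y
  Within (suc k) x y = Within k x y ⊎ Σ (Pt G) (λ z → Within k x z × Collinear z y)

  Dist : Pt G → Pt G → ℕ → Set
  Dist x y zero    = x ≡ y
  Dist x y (suc k) = Within (suc k) x y × ¬ Within k x y

  ConnectedOfDiameter : ℕ → Set
  ConnectedOfDiameter d = (∀ x y → Within d x y) × Σ (Pt G) (λ x → Σ (Pt G) (λ y → Dist x y d))

  NearestPointProperty : Set
  NearestPointProperty =
    ∀ x L → Σ (Pt G) λ p → T (inc G p L) × Σ ℕ λ k → Dist x p k
          × (∀ q → T (inc G q L) → q ≢ p → ¬ Within k x q)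

  IsNearPolygon : ℕ → Set   -- near 2d-gon
  IsNearPolygon d = IsPartialLinearSpace × ConnectedOfDiameter d × NearestPointProperty

  IsNearHexagon : Set
  IsNearHexagon = IsNearPolygon 3

  Sub : (Pt G → Bool) → (Ln G → Bool) → Geom
  Sub P L = record
    { Pt  = Σ (Pt G) (λ p → T (P p))
    ; Ln  = Σ (Ln G) (λ l → T (L l))
    ; inc = λ p l → inc G (proj₁ p) (proj₁ l) }


IsometricSub : (G : Geom) (P : Pt G → Bool) (L : Ln G → Bool) → Set
IsometricSub G P L = ∀ (x y : Pt (Sub G P L)) (k : ℕ) →
  Dist (Sub G P L) x y k ⇔ Dist G (proj₁ x) (proj₁ y) k

-- H(2,1): points are the flags of the Fano plane, lines are the points
-- and the lines of the Fano plane (the point-line dual of the incidence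
-- graph of the Fano plane).  Fano plane: points and lines Fin 7, point p
-- on line l iff p - l mod 7 ∈ {0,1,3} (a perfect difference set).

_≡ᶠ_ : Fin 7 → Fin 7 → Bool
p ≡ᶠ q = toℕ p ≡ᵇ toℕ q

fanoInc : Fin 7 → Fin 7 → Bool
fanoInc p l = (d ≡ᵇ 0) ∨ (d ≡ᵇ 1) ∨ (d ≡ᵇ 3)
  where d = (toℕ p + (7 ∸ toℕ l)) % 7

H21 : Geom
H21 = record
  { Pt  = Σ (Fin 7 × Fin 7) (λ f → T (fanoInc (proj₁ f) (proj₂ f)))
  ; Ln  = Fin 7 ⊎ Fin 7
  ; inc = λ { ((p , l) , _) (inj₁ q) → p ≡ᶠ q
            ; ((p , l) , _) (inj₂ m) → l ≡ᶠ m } }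

-- H(2): the split Cayley hexagon of order (2,2), in its standard
-- embedding in Q(6,2): points are the points of the quadric
-- X0X4 + X1X5 + X2X6 = X3² in PG(6,2); lines are the lines of Q(6,2)
-- whose Grassmann coordinates satisfy
--   p30 = p56, p31 = p46, p32 = p45, p34 = p12, p35 = p02, p36 = p01.
-- Over GF(2) a projective point is a nonzero vector of GF(2)^7, and a
-- line {a, b, a+b} is represented canonically by (a , b) with
-- a < b < a+b lexicographically.

F2⁷ : Set
F2⁷ = Vec Bool 7

infix 5 _!_
_!_ : F2⁷ → Fin 7 → Bool
v ! i = lookup v i

eqB : Bool → Bool → Bool
eqB x y = not (x xor y)

eqV : ∀ {n} → Vec Bool n → Vec Bool n → Bool
eqV []       []       = true
eqV (x ∷ xs) (y ∷ ys) = eqB x y ∧ eqV xs ys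

ltV : ∀ {n} → Vec Bool n → Vec Bool n → Bool
ltV []       []       = false
ltV (x ∷ xs) (y ∷ ys) = (not x ∧ y) ∨ (eqB x y ∧ ltV xs ys)

addV : ∀ {n} → Vec Bool n → Vec Bool n → Vec Bool n
addV []       []       = []
addV (x ∷ xs) (y ∷ ys) = (x xor y) ∷ addV xs ys

nonzero : ∀ {n} → Vec Bool n → Bool
nonzero []       = false
nonzero (x ∷ xs) = x ∨ nonzero xs

quadric : F2⁷ → Bool
quadric v = ((v ! # 0) ∧ (v ! # 4)) xor ((v ! # 1) ∧ (v ! # 5))
            xor ((v ! # 2) ∧ (v ! # 6)) xor (v ! # 3)

isQPoint : F2⁷ → Bool
isQPoint v = nonzero v ∧ not (quadric v)

pl : F2⁷ → F2⁷ → Fin 7 → Fin 7 → Bool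
pl a b i j = ((a ! i) ∧ (b ! j)) xor ((a ! j) ∧ (b ! i))

hexCond : F2⁷ → F2⁷ → Bool
hexCond a b =
  eqB (p (# 3) (# 0)) (p (# 5) (# 6)) ∧ eqB (p (# 3) (# 1)) (p (# 4) (# 6)) ∧
  eqB (p (# 3) (# 2)) (p (# 4) (# 5)) ∧ eqB (p (# 3) (# 4)) (p (# 1) (# 2)) ∧
  eqB (p (# 3) (# 5)) (p (# 0) (# 2)) ∧ eqB (p (# 3) (# 6)) (p (# 0) (# 1))
  where p = pl a b

isH2Line : F2⁷ → F2⁷ → Bool
isH2Line a b = isQPoint a ∧ isQPoint b ∧ isQPoint (addV a b)
             ∧ ltV a b ∧ ltV b (addV a b) ∧ hexCond a b

H2 : Geom
H2 = record
  { Pt  = Σ F2⁷ (λ v → T (isQPoint v))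
  ; Ln  = Σ (F2⁷ × F2⁷) (λ ab → T (isH2Line (proj₁ ab) (proj₂ ab)))
  ; inc = λ { (x , _) ((a , b) , _) → eqV x a ∨ eqV x b ∨ eqV x (addV a b) } }

Dual : Geom → Geom
Dual G = record { Pt = Ln G ; Ln = Pt G ; inc = λ L p → inc G p L }

H2D : Geom
H2D = Dual H2

{-# OPTIONS --safe #-}
-- The distances from a point u of N to the 21 points of the subhexagon S form a
-- "valuation": on every line of S its values are k, k+1, k+1 in some order.
-- There are finitely many valuations, and two principles restrict those which
-- occur.  The valuations of two points of a line determine that of the third
-- one, and a point of S at distance k+1 from u has distance k from a point on
-- one of the three lines through u.  This leaves 63 valuations, each belonging
-- to exactly one point.  The lines of N are identified with points of the
-- quadric by recording to which lines of S they are opposite.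
module Submission where

open import Defs
open import Data.Bool using (Bool; true; false; T; _∧_; _∨_; not; if_then_else_; T?; _xor_)
open import Data.Bool.ListAction using (all; any)
open import Data.Bool.Properties using (T-irrelevant; T-∧; T-∨)
open import Data.Empty using (⊥; ⊥-elim)
open import Data.Fin using (Fin; zero; suc; #_; toℕ) renaming (_<_ to _<ᶠ_)
import Data.Fin.Properties as Fin
open import Data.List using (List; []; _∷_; _++_; map; concatMap; filter; length; allFin; cartesianProduct)
open import Data.List.Membership.Propositional using (_∈_; find; lose)
open import Data.List.Membership.Propositional.Properties
  using (∈-map⁺; ∈-map⁻; ∈-++⁺ˡ; ∈-++⁺ʳ; ∈-++⁻; ∈-concatMap⁺; ∈-concatMap⁻; ∈-filter⁺; ∈-filter⁻; ∈-allFin)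
open import Data.List.Relation.Unary.Any using (here; there)
open import Data.List.Relation.Unary.Any.Properties using (any⁺; any⁻)
open import Data.Nat using (ℕ; zero; suc; pred; _≤_; _<_; z≤n; s≤s; _⊔_; _≡ᵇ_; _<ᵇ_; _≤ᵇ_; _≤?_)
open import Data.Nat.Properties using (≡ᵇ⇒≡; ≡⇒≡ᵇ; <⇒<ᵇ; ≤⇒≤ᵇ; ≤-refl; ≤-antisym; ≤-pred; ≰⇒>; n<1+n; n≤1+n;
  m≤n⇒m≤1+n; m≤n⇒m⊔n≡n; m≥n⇒m⊔n≡m)
open import Data.Product using (Σ; ∃; ∃₂; _×_; _,_; proj₁; proj₂)
open import Data.Sum using (_⊎_; inj₁; inj₂)
open import Data.Unit using (tt)
open import Data.Vec using (Vec; []; _∷_; lookup; zipWith; tabulate; replicate)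
open import Data.Vec.Properties using (lookup∘tabulate)
open import Function using (_∘_)
open import Function.Bundles using (Bijection; Equivalence; mk⤖)
open import Relation.Binary using (DecidableEquality)
open import Relation.Binary.PropositionalEquality using (_≡_; _≢_; refl; sym; trans; cong; cong₂; subst; subst₂)
open import Relation.Nullary using (Dec; ¬_; yes; no; contradiction)
open import Relation.Nullary.Decidable using (from-yes; _→-dec_; _×-dec_; _⊎-dec_; ¬?)

-- Decidable statements over finite sets

-- Each point of S lies on two lines of S and therefore on exactly one line leaving S. If every
-- point outside S has exactly one neighbour in S (type A), this leads to 21 + 21 · 2 = 63
-- valuations, as many as H(2) has lines. So it has to be excluded that a point outside S has no
-- neighbour in S, or several. Two neighbours (type B) are the obstacle: the other exclusions count
-- lines through a point, this one needs a global argument. If one point of S has a neighbour of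
-- type A, then all points of S have one, and the single line leaving S at a point never carries
-- both types. Hence one occurrence of type B forces type B at every point of S, in particular at
-- the centre of a grid, which yields a second grid conflicting with the first. Which valuations
-- belong to collinear points is not known in advance. The finite checks therefore quantify over all
-- pairs passing a necessary test such as `link`.

infix  9 holds_ fails_
infixr 6 _and_
infixr 5 _or_
infixr 4 _implies_

-- Only soundness of `decide` is proved. Negations and premises would need completeness as well, so
-- they are restricted to Booleans. Matching on the premise also spares the evaluation of the
-- conclusion when the premise fails.
data Form : Set₁ where
  holds_ fails_  : Bool → Form
  _and_ _or_     : Form → Form → Form
  _implies_      : Bool → Form → Form
  every some     : {A : Set} → List A → (A → Form) → Form
  everyᶠ someᶠ   : {n : ℕ} → (Fin n → Form) → Form

decide : Form → Bool
decide (holds b)         = b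
decide (fails b)         = not b
decide (φ and ψ)         = decide φ ∧ decide ψ
decide (φ or ψ)          = decide φ ∨ decide ψ
decide (true implies φ)  = decide φ
decide (false implies φ) = true
decide (every xs φ)      = all (λ x → decide (φ x)) xs
decide (some xs φ)       = any (λ x → decide (φ x)) xs
decide (everyᶠ φ)        = all (λ i → decide (φ i)) (allFin _)
decide (someᶠ φ)         = any (λ i → decide (φ i)) (allFin _)

⟦_⟧ : Form → Set
⟦ holds b ⟧     = T b
⟦ fails b ⟧     = ¬ T b
⟦ φ and ψ ⟧     = ⟦ φ ⟧ × ⟦ ψ ⟧
⟦ φ or ψ ⟧      = ⟦ φ ⟧ ⊎ ⟦ ψ ⟧
⟦ b implies φ ⟧ = T b → ⟦ φ ⟧
⟦ every xs φ ⟧  = ∀ {x} → x ∈ xs → ⟦ φ x ⟧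
⟦ some xs φ ⟧   = ∃ λ x → x ∈ xs × ⟦ φ x ⟧
⟦ everyᶠ φ ⟧    = ∀ i → ⟦ φ i ⟧
⟦ someᶠ φ ⟧     = ∃ λ i → ⟦ φ i ⟧

all-∈ : ∀ {A : Set} (p : A → Bool) {xs x} → T (all p xs) → x ∈ xs → T (p x)
all-∈ p h (here refl) = proj₁ (Equivalence.to T-∧ h)
all-∈ p {y ∷ _} h (there x∈xs) = all-∈ p (proj₂ (Equivalence.to (T-∧ {p y}) h)) x∈xs

any-∃ : ∀ {A : Set} (p : A → Bool) xs → T (any p xs) → ∃ λ x → x ∈ xs × T (p x)
any-∃ p xs = find ∘ any⁻ p xs

T-not : ∀ {b} → T (not b) → ¬ T b
T-not {false} _ ()

sound : ∀ φ → T (decide φ) → ⟦ φ ⟧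
sound (holds b) h = h
sound (fails b) h = T-not h
sound (φ and ψ) h with Equivalence.to (T-∧ {decide φ}) h
... | hφ , hψ = sound φ hφ , sound ψ hψ
sound (φ or ψ) h with Equivalence.to (T-∨ {decide φ}) h
... | inj₁ hφ = inj₁ (sound φ hφ)
... | inj₂ hψ = inj₂ (sound ψ hψ)
sound (true implies φ) h = λ _ → sound φ h
sound (false implies φ) h = λ ()
sound (every xs φ) h x∈xs = sound (φ _) (all-∈ _ h x∈xs)
sound (some xs φ) h with any-∃ _ xs h
... | x , x∈xs , hx = x , x∈xs , sound (φ x) hx
sound (everyᶠ φ) h i = sound (φ i) (all-∈ _ h (∈-allFin i))
sound (someᶠ φ) h with any-∃ _ (allFin _) h
... | i , _ , hi = i , sound (φ i) hi

-- A hypothesis T (decide φ) would itself be a redex and be evaluated repeatedly.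
by-computation : ∀ φ → decide φ ≡ true → ⟦ φ ⟧
by-computation φ eq = sound φ (subst T (sym eq) tt)

-- Valuations of H(2,1)

infix 7 _==_
_==_ : ∀ {n} → Vec ℕ n → Vec ℕ n → Bool
[]       == []       = true
(x ∷ xs) == (y ∷ ys) = (x ≡ᵇ y) ∧ (xs == ys)

==⇒≡ : ∀ {n} {f g : Vec ℕ n} → T (f == g) → f ≡ g
==⇒≡ {f = []}    {[]}    _ = refl
==⇒≡ {f = x ∷ _} {y ∷ _} h with Equivalence.to (T-∧ {x ≡ᵇ y}) h
... | hx , hs = cong₂ _∷_ (≡ᵇ⇒≡ x y hx) (==⇒≡ hs)

≡⇒== : ∀ {n} {f g : Vec ℕ n} → f ≡ g → T (f == g)
≡⇒== {f = []}     refl = tt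
≡⇒== {f = x ∷ xs} refl = Equivalence.from T-∧ (≡⇒≡ᵇ x x refl , ≡⇒== {f = xs} refl)

nearest : ℕ → ℕ → ℕ → Bool
nearest a b c = (b ≡ᵇ suc a) ∧ (c ≡ᵇ suc a)

lineOK : ℕ → ℕ → ℕ → Bool
lineOK a b c = nearest a b c ∨ nearest b a c ∨ nearest c a b

-- A line is listed at its point of least index, by the indices of its two
-- other points counted from the successor of that point.
data Steps : ℕ → Set where
  []  : Steps 0
  _∷_ : ∀ {n} → List (Fin n × Fin n) → Steps n → Steps (suc n)

triples : ∀ {n} → Steps n → List (Fin n × Fin n × Fin n)
triples []       = []
triples (s ∷ ss) = map (λ (j , k) → zero , suc j , suc k) s
                ++ map (λ (i , j , k) → suc i , suc j , suc k) (triples ss)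

OnLines : ∀ {n} → Steps n → Vec ℕ n → Set
OnLines ss f = ∀ {i j k} → (i , j , k) ∈ triples ss → T (lineOK (lookup f i) (lookup f j) (lookup f k))

extends : ∀ {n} → List (Fin n × Fin n) → Vec ℕ n → ℕ → Bool
extends s f v = all (λ (j , k) → lineOK v (lookup f j) (lookup f k)) s

-- Values are chosen from the last point backwards, and a line is tested as soon as its point of
-- least index receives a value; this prunes the search among the 4^21 vectors. The bound 3 is the
-- diameter.
enumerate : ∀ {n} → Steps n → List (Vec ℕ n)
enumerate []       = [] ∷ []
enumerate (s ∷ ss) =
  concatMap (λ f → map (_∷ f) (filter (T? ∘ extends s f) (0 ∷ 1 ∷ 2 ∷ 3 ∷ []))) (enumerate ss)

all-from : ∀ {A : Set} (p : A → Bool) xs → (∀ {x} → x ∈ xs → T (p x)) → T (all p xs)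
all-from p []       h = tt
all-from p (x ∷ xs) h = Equivalence.from T-∧ (h (here refl) , all-from p xs (h ∘ there))

enumerate-complete : ∀ {n} (ss : Steps n) (f : Vec ℕ n) →
  (∀ i → lookup f i ≤ 3) → OnLines ss f → f ∈ enumerate ss
enumerate-complete []       []      _  _  = here refl
enumerate-complete (s ∷ ss) (v ∷ f) ≤3 on = ∈-concatMap⁺
  (λ f → map (_∷ f) (filter (T? ∘ extends s f) (0 ∷ 1 ∷ 2 ∷ 3 ∷ [])))
  (lose (enumerate-complete ss f (≤3 ∘ suc) (λ t∈ → on (∈-++⁺ʳ _ (∈-map⁺ _ t∈))))
        (∈-map⁺ (_∷ f) (∈-filter⁺ (T? ∘ extends s f) (≤3⇒∈ (≤3 zero))
          (all-from _ s λ p∈s → on (∈-++⁺ˡ (∈-map⁺ _ p∈s))))))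
  where
  ≤3⇒∈ : ∀ {v} → v ≤ 3 → v ∈ 0 ∷ 1 ∷ 2 ∷ 3 ∷ []
  ≤3⇒∈ z≤n                   = here refl
  ≤3⇒∈ (s≤s z≤n)             = there (here refl)
  ≤3⇒∈ (s≤s (s≤s z≤n))       = there (there (here refl))
  ≤3⇒∈ (s≤s (s≤s (s≤s z≤n))) = there (there (there (here refl)))

flags : Vec (Pt H21) 21
flags = ((# 2 , # 2) , _) ∷ ((# 3 , # 2) , _) ∷ ((# 2 , # 6) , _)
      ∷ ((# 3 , # 0) , _) ∷ ((# 0 , # 0) , _) ∷ ((# 0 , # 6) , _)
      ∷ ((# 0 , # 4) , _) ∷ ((# 5 , # 2) , _) ∷ ((# 5 , # 4) , _)
      ∷ ((# 4 , # 4) , _) ∷ ((# 3 , # 3) , _) ∷ ((# 4 , # 3) , _)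
      ∷ ((# 6 , # 3) , _) ∷ ((# 6 , # 6) , _) ∷ ((# 2 , # 1) , _)
      ∷ ((# 4 , # 1) , _) ∷ ((# 6 , # 5) , _) ∷ ((# 5 , # 5) , _)
      ∷ ((# 1 , # 5) , _) ∷ ((# 1 , # 1) , _) ∷ ((# 1 , # 0) , _) ∷ []

opaque
  steps : Steps 21
  steps = ((# 1 , # 13) ∷ (# 0 , # 6) ∷ []) ∷ ((# 1 , # 8) ∷ []) ∷ ((# 2 , # 10) ∷ [])
        ∷ ((# 0 , # 16) ∷ []) ∷ ((# 0 , # 1) ∷ []) ∷ [] ∷ ((# 1 , # 2) ∷ [])
        ∷ ((# 0 , # 9) ∷ []) ∷ [] ∷ ((# 1 , # 5) ∷ []) ∷ ((# 0 , # 1) ∷ []) ∷ []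
        ∷ ((# 0 , # 3) ∷ []) ∷ [] ∷ ((# 0 , # 4) ∷ []) ∷ [] ∷ ((# 0 , # 1) ∷ [])
        ∷ [] ∷ ((# 0 , # 1) ∷ []) ∷ [] ∷ [] ∷ []

Ix : Set
Ix = Fin 21

point line : Ix → Fin 7
point i = proj₁ (proj₁ (lookup flags i))
line  i = proj₂ (proj₁ (lookup flags i))

differ : Ix → Ix → Bool
differ i j = not ((point i ≡ᶠ point j) ∧ (line i ≡ᶠ line j))

-- Flags (p , l) and (q , m) are at distance at most 2 exactly if one of
-- (p , m), (q , l) is a flag.
near : Pt H21 → Pt H21 → Bool
near ((p , l) , _) ((q , m) , _) = fanoInc p m ∨ fanoInc q l

near2 : Ix → Ix → Bool
near2 i j = near (lookup flags i) (lookup flags j)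

Val : Set
Val = Vec ℕ 21

at : Val → Ix → ℕ
at = lookup

-- Points at distance 3 in S must not come closer together in N.
isometric : Val → Bool
isometric f = all (λ i → not (at f i ≡ᵇ 0) ∨ all (λ j → near2 i j ∨ (at f j ≡ᵇ 3)) (allFin 21)) (allFin 21)

-- The value of the third point of a line, given those of two of its points.
third₁ : ℕ → ℕ → ℕ
third₁ a b = if a ≡ᵇ b then pred a else a ⊔ b

third : ∀ {n} → Vec ℕ n → Vec ℕ n → Vec ℕ n
third = zipWith third₁

close : ∀ {n} → Vec ℕ n → Vec ℕ n → Bool
close []       []       = true
close (a ∷ as) (b ∷ bs) = (a ≤ᵇ suc b) ∧ (b ≤ᵇ suc a) ∧ close as bs

opaque
  row : Ix → Val
  row i = tabulate λ j →
    if toℕ i ≡ᵇ toℕ j then 0 else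
    if (point i ≡ᶠ point j) ∨ (line i ≡ᶠ line j) then 1 else
    if near2 i j then 2 else 3

  rows : Vec Val 21
  rows = tabulate row

  link : List Val → Val → Val → Bool
  link X f g = close f g ∧ any (third f g ==_) X

  onLine : Val → Val → Val → Bool
  onLine f g h = h == g ∨ h == third f g

  covers : Val → Val → Ix → Bool
  covers f g i = (at g i <ᵇ at f i) ∨ (at (third f g) i <ᵇ at f i)

  level : ℕ → Val → List Ix
  level k f = filter (λ i → T? (at f i ≡ᵇ k)) (allFin 21)

  fourOf : List Ix → Vec Ix 4
  fourOf (a ∷ b ∷ c ∷ d ∷ _) = a ∷ b ∷ c ∷ d ∷ []
  -- The default does no harm: `unblocked` refutes `blocked` for any four points, also for repeated
  -- ones.
  fourOf _                   = zero ∷ zero ∷ zero ∷ zero ∷ []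

  -- The valuations of the points of S are classical; a point outside S has type
  -- A or B if it has one or two neighbours in S.
  classical isA isB fewOnes someOnes : Val → Bool
  classical f = any (λ i → at f i ≡ᵇ 0) (allFin 21)
  isA f       = not (classical f) ∧ (length (level 1 f) ≡ᵇ 1)
  isB f       = not (classical f) ∧ (length (level 1 f) ≡ᵇ 2)
  fewOnes f   = classical f ∨ (length (level 1 f) <ᵇ 4)
  someOnes f  = classical f ∨ (0 <ᵇ length (level 1 f))

  okB : Val → Val → Bool
  okB f g = not (isB f) ∨ isB g ∨ classical g

  linkB : List Val → Val → Val → Bool
  linkB X f g = link X f g ∧ okB f g ∧ okB g f ∧ okB (third f g) f

  lookup-rows : ∀ i → lookup rows i ≡ row i
  lookup-rows = lookup∘tabulate row

  link⁺ : ∀ {X f g} → T (close f g) → third f g ∈ X → T (link X f g)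
  link⁺ {X} {f} {g} c t∈ = Equivalence.from T-∧ (c , any⁺ (third f g ==_) (lose t∈ (≡⇒== {f = third f g} refl)))

  onLine⁺ : ∀ {f g h} → h ≡ g ⊎ h ≡ third f g → T (onLine f g h)
  onLine⁺ (inj₁ eq) = Equivalence.from T-∨ (inj₁ (≡⇒== eq))
  onLine⁺ {f} {g} {h} (inj₂ eq) = Equivalence.from (T-∨ {h == g}) (inj₂ (≡⇒== eq))

  onLine⁻ : ∀ {f g h} → T (onLine f g h) → h ≡ g ⊎ h ≡ third f g
  onLine⁻ {f} {g} {h} o with Equivalence.to (T-∨ {h == g}) o
  ... | inj₁ eq = inj₁ (==⇒≡ eq)
  ... | inj₂ eq = inj₂ (==⇒≡ eq)

  onLine⇒covers : ∀ {f g h i} → T (onLine f g h) → at h i < at f i → T (covers f g i)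
  onLine⇒covers {f} {g} {h} {i} o lt with onLine⁻ {f} {g} {h} o
  ... | inj₁ refl = Equivalence.from T-∨ (inj₁ (<⇒<ᵇ lt))
  ... | inj₂ refl = Equivalence.from (T-∨ {at g i <ᵇ at f i}) (inj₂ (<⇒<ᵇ lt))

  level⁺ : ∀ {k f i} → T (at f i ≡ᵇ k) → i ∈ level k f
  level⁺ {k} {f} {i} h = ∈-filter⁺ (λ i → T? (at f i ≡ᵇ k)) (∈-allFin i) h

  level⁻ : ∀ {k f i} → i ∈ level k f → T (at f i ≡ᵇ k)
  level⁻ {k} {f} i∈ = proj₂ (∈-filter⁻ (λ i → T? (at f i ≡ᵇ k)) {xs = allFin 21} i∈)

  classical⁻ : ∀ {f} → T (classical f) → ∃ λ i → T (at f i ≡ᵇ 0)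
  classical⁻ {f} h with any-∃ (λ i → at f i ≡ᵇ 0) (allFin 21) h
  ... | i , _ , hi = i , hi

  isA⇒¬classical : ∀ {f} → T (isA f) → ¬ T (classical f)
  isA⇒¬classical h = T-not (proj₁ (Equivalence.to T-∧ h))

  isB⇒¬classical : ∀ {f} → T (isB f) → ¬ T (classical f)
  isB⇒¬classical h = T-not (proj₁ (Equivalence.to T-∧ h))

  linkB⁺ : ∀ {X f g} → T (link X f g) → T (okB f g) → T (okB g f) → T (okB (third f g) f) → T (linkB X f g)
  linkB⁺ {f = f} {g} l p q r =
    Equivalence.from T-∧ (l , Equivalence.from T-∧ (p , Equivalence.from T-∧ (q , r)))

  okB⁺ : ∀ {f g} → (T (isB f) → T (isB g ∨ classical g)) → T (okB f g)
  okB⁺ {f} h with isB f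
  ... | false = tt
  ... | true  = h tt

-- No line through a point with valuation f comes closer to two of the four
-- points c, so that four lines would be needed.
blocked : (Val → Val → Bool) → List Val → ℕ → Val → Vec Ix 4 → Form
blocked R X k f c =
  everyᶠ (λ m → holds (at f (lookup c m) ≡ᵇ suc k)) and
  every X (λ g → R f g implies everyᶠ λ m → everyᶠ λ n → (toℕ m <ᵇ toℕ n) implies
    fails (covers f g (lookup c m) ∧ covers f g (lookup c n)))

-- Finite statements about valuations

module Claims where

  lines : Form
  lines = every (triples steps) λ (i , j , k) →
    holds (differ i j) and holds (differ i k) and holds (differ j k) and
    some (map inj₁ (allFin 7) ++ map inj₂ (allFin 7)) λ m →
      holds (inc H21 (lookup flags i) m) and holds (inc H21 (lookup flags j) m) and holds (inc H21 (lookup flags k) m)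

  rigid : List Val → Form
  rigid X = every X λ f → everyᶠ λ i → (at f i ≡ᵇ 0) implies holds (f == row i)

  -- Geometrically, a line joining two points of S belongs to S, so the neighbours in S of a point
  -- outside S lie on different lines through it, of which there are three.
  few : List Val → Form
  few X = every X λ f → holds (fewOnes f) or blocked (link X) X 0 f (fourOf (level 1 f))

  -- f has type B, and ra, rb are the valuations of its two neighbours in S: a
  -- neighbour g on the third line has type B, or else one of the values of f
  -- is not decreased on any of the three lines.
  Bescape : Val → Val → Val → Val → Form
  Bescape f ra rb g = holds (isB g ∨ classical g) or
    (fails (onLine f ra g) and fails (onLine f rb g) and
     someᶠ λ i → holds (0 <ᵇ at f i) and fails (covers f ra i) and fails (covers f rb i) and fails (covers f g i))

  Bneighbour : List Val → Val → Val → Val → Form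
  Bneighbour X f ra rb = every X λ g → link X f g implies Bescape f ra rb g

  Bneighbours : List Val → Form
  Bneighbours X = every X λ f → isB f implies someᶠ λ a → someᶠ λ b →
    holds (at f a ≡ᵇ 1) and holds (at f b ≡ᵇ 1) and fails (onLine f (row a) (row b)) and
    Bneighbour X f (row a) (row b)

  -- A valuation without the values 0 and 1 has the value 2 once on each line and 3 elsewhere. Since
  -- the points of S are the edges of the Heawood graph and its lines the vertices, these are the 24
  -- perfect matchings of that graph.
  ones : List Val → Form
  ones X = every X λ f → holds (someOnes f) or blocked (linkB X) X 1 f (fourOf (level 2 f))

  types : List Val → Form
  types X = every X λ f → holds (classical f) or holds (isA f) or holds (isB f)

  Aopposite : List Val → Form
  Aopposite X = every X λ f → isA f implies everyᶠ λ i → (at f i ≡ᵇ 1) implies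
    (holds (isA (third (row i) f)) and
     everyᶠ λ j → (at (row i) j ≡ᵇ 3) implies (holds (at f j ≡ᵇ 2) or holds (at (third (row i) f) j ≡ᵇ 2)))

  Aneighbours : List Val → Form
  Aneighbours X = every X λ f → isA f implies everyᶠ λ i → (at f i ≡ᵇ 1) implies every X λ g → linkB X f g implies
    (holds (isA g) or everyᶠ λ j → (at (row i) j ≡ᵇ 3) implies fails (at g j ≡ᵇ 1))

  -- A property passed on to opposite points of S thus reaches every point in two steps.
  hop : Form
  hop = everyᶠ λ i → everyᶠ λ k → someᶠ λ j → holds (at (row i) j ≡ᵇ 3) and holds (at (row j) k ≡ᵇ 3)

  AnotB : List Val → Form
  AnotB X = every X λ f → isA f implies everyᶠ λ i → (at f i ≡ᵇ 1) implies every X λ g →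
    onLine (row i) f g implies fails (isB g)

  threeRows : Val → List Ix → Form
  threeRows r is = every is λ a → every is λ b → every is λ c →
    holds (onLine r (row a) (row b)) or holds (onLine r (row a) (row c)) or holds (onLine r (row b) (row c))

  -- Only two lines of S pass through a point. The first half serves to find a line of N leaving S
  -- there, the second to show that it is the only one.
  twoLines : Form
  twoLines = everyᶠ λ i → threeRows (row i) (level 1 (row i)) and
    someᶠ λ a → holds (at (row i) a ≡ᵇ 1) and someᶠ λ b → holds (at (row i) b ≡ᵇ 1) and
    fails (onLine (row i) (row a) (row b)) and
    holds (classical (row a)) and holds (classical (third (row i) (row a))) and
    holds (classical (row b)) and holds (classical (third (row i) (row b)))

  -- A point of type B spans a grid with the two points of S adjacent to it and
  -- the common neighbour z of these, the centre.  The third points of the lines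
  -- joining a member of the grid to its neighbours in S again lie in the grid.
  -- If z had type B as well, the two grids would lead to a point r of S with
  -- two lines leaving S.  The table ρ of the valuations of S is a parameter in
  -- order to be computed once only; likewise X in starsOf and imagesOf below.
  grow : Vec Val 21 → List Val → List Val
  grow ρ fs = fs ++ concatMap (λ h → map (λ a → third (lookup ρ a) h) (level 1 h)) fs

  clash : Vec Val 21 → List Val → List Val → Form
  clash ρ fs gs = some fs λ f → some gs λ g → fails (classical f) and fails (classical g) and
    someᶠ λ r → holds (at f r ≡ᵇ 1) and holds (at g r ≡ᵇ 1) and fails (onLine (lookup ρ r) f g)

  centred : Vec Val 21 → List Val → List Val → Ix → Form
  centred ρ fs Bs z = every Bs λ g → (at g z ≡ᵇ 1) implies clash ρ fs (grow ρ (grow ρ (g ∷ [])))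

  centre : Vec Val 21 → List Val → Form
  centre ρ Bs = every Bs λ f → (someᶠ λ a → holds (at f a ≡ᵇ 1)) and
    someᶠ λ z → every (level 1 f) (λ a → holds (at (lookup ρ z) a ≡ᵇ 1)) and
      centred ρ (grow ρ (grow ρ (f ∷ []))) Bs z

  hasOne : List Val → Form
  hasOne X = every X λ f → holds (classical f) or someᶠ λ i → holds (at f i ≡ᵇ 1)

  -- The two points outside S on the line leaving S at a point have different valuations, and no
  -- other non-classical valuation has this point as a neighbour. The first fact makes `F`
  -- injective, the second makes every member of `X3` occur.
  pair : List Val → Form
  pair X = every X λ f → holds (classical f) or everyᶠ λ i → (at f i ≡ᵇ 1) implies
    (fails (f == third (row i) f) and
     every X λ g → holds (classical g) or ((at g i ≡ᵇ 1) implies holds (onLine (row i) f g)))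

-- 279, 171, 147 and 63 valuations; X1 leaves out points with at least four
-- neighbours in S, X2 those with none and X3 those with two.
opaque
  X0 X1 X2 X3 Bs : List Val
  X0 = filter (T? ∘ isometric) (enumerate steps)
  X1 = filter (T? ∘ fewOnes) X0
  X2 = filter (T? ∘ someOnes) X1
  X3 = filter (λ f → T? (not (isB f))) X2
  Bs = filter (T? ∘ isB) X2

opaque
  unfolding X0

  X0⁺ : ∀ {f} → f ∈ enumerate steps → T (isometric f) → f ∈ X0
  X0⁺ = ∈-filter⁺ (T? ∘ isometric)

  X1⁺ : ∀ {f} → f ∈ X0 → T (fewOnes f) → f ∈ X1
  X1⁺ = ∈-filter⁺ (T? ∘ fewOnes)

  X2⁺ : ∀ {f} → f ∈ X1 → T (someOnes f) → f ∈ X2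
  X2⁺ = ∈-filter⁺ (T? ∘ someOnes)

  X3⁺ : ∀ {f} → f ∈ X2 → ¬ T (isB f) → f ∈ X3
  X3⁺ f∈ ¬B = ∈-filter⁺ (λ f → T? (not (isB f))) f∈ (not-T ¬B)
    where
    not-T : ∀ {b} → ¬ T b → T (not b)
    not-T {false} _ = tt
    not-T {true} ¬b = ⊥-elim (¬b tt)

  Bs⁺ : ∀ {f} → f ∈ X2 → T (isB f) → f ∈ Bs
  Bs⁺ = ∈-filter⁺ (T? ∘ isB)

  X3⊆X0 : ∀ {f} → f ∈ X3 → f ∈ X0
  X3⊆X0 f∈ = proj₁ (∈-filter⁻ (T? ∘ fewOnes) (proj₁ (∈-filter⁻ (T? ∘ someOnes) {xs = X1}
    (proj₁ (∈-filter⁻ (λ f → T? (not (isB f))) {xs = X2} f∈)))))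

opaque
  unfolding X0 link steps

  lines-claim : ⟦ Claims.lines ⟧
  lines-claim = by-computation Claims.lines refl

  rigid-claim : ⟦ Claims.rigid X0 ⟧
  rigid-claim = by-computation (Claims.rigid X0) refl

  few-claim : ⟦ Claims.few X0 ⟧
  few-claim = by-computation (Claims.few X0) refl

  Bneighbours-claim : ⟦ Claims.Bneighbours X1 ⟧
  Bneighbours-claim = by-computation (Claims.Bneighbours X1) refl

  ones-claim : ⟦ Claims.ones X1 ⟧
  ones-claim = by-computation (Claims.ones X1) refl

  types-claim : ⟦ Claims.types X2 ⟧
  types-claim = by-computation (Claims.types X2) refl

  Aopposite-claim : ⟦ Claims.Aopposite X2 ⟧
  Aopposite-claim = by-computation (Claims.Aopposite X2) refl

  Aneighbours-claim : ⟦ Claims.Aneighbours X2 ⟧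
  Aneighbours-claim = by-computation (Claims.Aneighbours X2) refl

  hop-claim : ⟦ Claims.hop ⟧
  hop-claim = by-computation Claims.hop refl

  AnotB-claim : ⟦ Claims.AnotB X2 ⟧
  AnotB-claim = by-computation (Claims.AnotB X2) refl

  twoLines-claim : ⟦ Claims.twoLines ⟧
  twoLines-claim = by-computation Claims.twoLines refl

  centre-claim : ⟦ Claims.centre rows Bs ⟧
  centre-claim = by-computation (Claims.centre rows Bs) refl

  hasOne-claim : ⟦ Claims.hasOne X3 ⟧
  hasOne-claim = by-computation (Claims.hasOne X3) refl

  pair-claim : ⟦ Claims.pair X3 ⟧
  pair-claim = by-computation (Claims.pair X3) refl

-- Points p, q of H(2) are opposite exactly if they are not orthogonal on the
-- quadric.  As e₀, e₁, e₂ and e₄, e₅, e₆ are dual to each other, the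
-- coordinates of a line K tell to which of six lines of S it is opposite.  These
-- correspond to the vertices 0, 1, 2 and the sides 1, 6, 0 of a triangle of the
-- Fano plane.
-- The coordinate x₃ is then given by the equation of the quadric.
opposite : (Ix → Bool) → Val → Val → Bool
opposite on f g = all (λ i → not (on i) ∨ ((1 <ᵇ at f i) ∧ (1 <ᵇ at g i) ∧ (1 <ᵇ at (third f g) i))) (allFin 21)

opaque
  coords : Val → Val → F2⁷
  coords f g = complete (side (# 1)) (side (# 6)) (side (# 0)) (vertex (# 0)) (vertex (# 1)) (vertex (# 2))
    where
    vertex side : Fin 7 → Bool
    vertex p = opposite (λ i → point i ≡ᶠ p) f g
    side   l = opposite (λ i → line i ≡ᶠ l) f g
    complete : Bool → Bool → Bool → Bool → Bool → Bool → F2⁷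
    complete a b c x y z = a ∷ b ∷ c ∷ ((a ∧ x) xor (b ∧ y) xor (c ∧ z)) ∷ x ∷ y ∷ z ∷ []

-- Valuations as lines of H(2)

F2⁷² : Set
F2⁷² = F2⁷ × F2⁷

h2Line : F2⁷² → Bool
h2Line (a , b) = isH2Line a b

_on_ : F2⁷ → F2⁷² → Bool
x on (a , b) = eqV x a ∨ eqV x b ∨ eqV x (addV a b)

firstLine : List F2⁷² → F2⁷²
-- The zero pair is not a line of H(2), so `images-claim` also certifies that the search succeeds.
firstLine []       = zeros , zeros
  where zeros = replicate 7 false
firstLine (l ∷ ls) = if h2Line l then l else firstLine ls

Star : Set
Star = Val × List (Val × F2⁷)

star : List Val → Val → Star
star X f = f , map (λ g → g , coords f g) (filter (λ g → T? (link X f g)) X)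

image : Star → F2⁷²
image (f , gs) = firstLine (cartesianProduct (map proj₂ gs) (map proj₂ gs))

vectors : ∀ n → List (Vec Bool n)
vectors zero    = [] ∷ []
vectors (suc n) = map (true ∷_) (vectors n) ++ map (false ∷_) (vectors n)

∈-vectors : ∀ {n} (v : Vec Bool n) → v ∈ vectors n
∈-vectors []                = here refl
∈-vectors (true ∷ v)        = ∈-++⁺ˡ (∈-map⁺ _ (∈-vectors v))
∈-vectors {suc n} (false ∷ v) = ∈-++⁺ʳ (map (true ∷_) (vectors n)) (∈-map⁺ _ (∈-vectors v))

withImage : Star → Star × F2⁷²
withImage s = s , image s

starsOf : List Val → List Star
starsOf X = map (star X) X

imagesOf : List Val → List (Star × F2⁷²)
imagesOf X = map (λ f → withImage (star X f)) X

module Coordinates where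

  images : List (Star × F2⁷²) → Form
  images S = every S λ ((f , gs) , ab) → holds (h2Line ab) and
    every gs λ (g , x) → holds (isQPoint x) and holds (x on ab)

  -- The two transpositions tested here generate all permutations of the three points of a line;
  -- hence the coordinates depend on the line alone.
  symmetric : List Star → Form
  symmetric S = every S λ (f , gs) → every gs λ (g , x) →
    holds (eqV x (coords g f)) and holds (eqV x (coords f (third f g)))

  reflecting : List (Star × F2⁷²) → Form
  reflecting S = every S λ ((f , _) , ab) → every S λ ((g , hs) , _) → every hs λ (h , x) →
    (x on ab) implies (holds (f == g) or holds (f == h) or holds (f == third g h))

  injective : List (Star × F2⁷²) → Form
  injective S = every S λ ((f , _) , (a , b)) → every S λ ((g , _) , (c , d)) →
    (eqV a c ∧ eqV b d) implies holds (f == g)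

  surjective : List (Star × F2⁷²) → Form
  surjective S = every (vectors 7) λ a → isQPoint a implies every (vectors 7) λ b → isH2Line a b implies
    some S λ (_ , (c , d)) → holds (eqV a c ∧ eqV b d)

  -- Linked valuations need not be known to come from collinear points, so a pair with coordinates x
  -- does not yet give a line of N. The index i does: the point with valuation f has a neighbour
  -- nearer to `s i`, and whatever its valuation, the line to it has coordinates x.
  covering : List Star → Form
  covering S = every (vectors 7) λ x → isQPoint x implies some S λ (f , gs) →
    some gs (λ (_ , y) → holds (eqV x y)) and
    someᶠ λ i → holds (0 <ᵇ at f i) and every gs λ (g , y) → (at g i <ᵇ at f i) implies holds (eqV x y)

opaque
  lineOf : Val → F2⁷²
  lineOf f = image (star X3 f)

  stars : List Star
  stars = starsOf X3

  images : List (Star × F2⁷²)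
  images = imagesOf X3

opaque
  unfolding X0 link steps coords lineOf

  images-claim : ⟦ Coordinates.images images ⟧
  images-claim = by-computation (Coordinates.images images) refl

  symmetric-claim : ⟦ Coordinates.symmetric stars ⟧
  symmetric-claim = by-computation (Coordinates.symmetric stars) refl

  reflecting-claim : ⟦ Coordinates.reflecting images ⟧
  reflecting-claim = by-computation (Coordinates.reflecting images) refl

  injective-claim : ⟦ Coordinates.injective images ⟧
  injective-claim = by-computation (Coordinates.injective images) refl

  surjective-claim : ⟦ Coordinates.surjective images ⟧
  surjective-claim = by-computation (Coordinates.surjective images) refl

  covering-claim : ⟦ Coordinates.covering stars ⟧
  covering-claim = by-computation (Coordinates.covering stars) refl

opaque
  unfolding lineOf

  star-∈ : ∀ {f} → f ∈ X3 → star X3 f ∈ stars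
  star-∈ = ∈-map⁺ (star X3)

  stars-∈⁻ : ∀ {s} → s ∈ stars → ∃ λ f → f ∈ X3 × s ≡ star X3 f
  stars-∈⁻ = ∈-map⁻ (star X3)

  image-∈ : ∀ {f} → f ∈ X3 → (star X3 f , lineOf f) ∈ images
  image-∈ = ∈-map⁺ (λ f → withImage (star X3 f))

  images-∈⁻ : ∀ {s} → s ∈ images → ∃ λ f → f ∈ X3 × s ≡ (star X3 f , lineOf f)
  images-∈⁻ = ∈-map⁻ (λ f → withImage (star X3 f))

leaf-∈ : ∀ {f g} → g ∈ X3 → T (link X3 f g) → (g , coords f g) ∈ proj₂ (star X3 f)
leaf-∈ {f} g∈ l = ∈-map⁺ _ (∈-filter⁺ (λ g → T? (link X3 f g)) g∈ l)

eqV-refl : ∀ {n} (x : Vec Bool n) → T (eqV x x)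
eqV-refl []          = tt
eqV-refl (true ∷ x)  = eqV-refl x
eqV-refl (false ∷ x) = eqV-refl x

eqV⇒≡ : ∀ {n} {x y : Vec Bool n} → T (eqV x y) → x ≡ y
eqV⇒≡ {x = []}        {[]}        _ = refl
eqV⇒≡ {x = true ∷ _}  {true ∷ _}  h = cong (true ∷_) (eqV⇒≡ h)
eqV⇒≡ {x = false ∷ _} {false ∷ _} h = cong (false ∷_) (eqV⇒≡ h)

lineOf-isH2Line : ∀ {f} → f ∈ X3 → T (h2Line (lineOf f))
lineOf-isH2Line f∈ = proj₁ (images-claim (image-∈ f∈))

coords-isQPoint : ∀ {f g} → f ∈ X3 → g ∈ X3 → T (link X3 f g) → T (isQPoint (coords f g))
coords-isQPoint f∈ g∈ l = proj₁ (proj₂ (images-claim (image-∈ f∈)) (leaf-∈ g∈ l))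

coords-on-lineOf : ∀ {f g} → f ∈ X3 → g ∈ X3 → T (link X3 f g) → T (coords f g on lineOf f)
coords-on-lineOf f∈ g∈ l = proj₂ (proj₂ (images-claim (image-∈ f∈)) (leaf-∈ g∈ l))

coords-sym : ∀ {f g} → f ∈ X3 → g ∈ X3 → T (link X3 f g) → coords f g ≡ coords g f
coords-sym f∈ g∈ l = eqV⇒≡ (proj₁ (symmetric-claim (star-∈ f∈) (leaf-∈ g∈ l)))

coords-third : ∀ {f g} → f ∈ X3 → g ∈ X3 → T (link X3 f g) → coords f g ≡ coords f (third f g)
coords-third f∈ g∈ l = eqV⇒≡ (proj₂ (symmetric-claim (star-∈ f∈) (leaf-∈ g∈ l)))

on-lineOf-reflects : ∀ {f g h} → f ∈ X3 → g ∈ X3 → h ∈ X3 → T (link X3 g h) →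
  T (coords g h on lineOf f) → f ≡ g ⊎ f ≡ h ⊎ f ≡ third g h
on-lineOf-reflects f∈ g∈ h∈ l on with reflecting-claim (image-∈ f∈) (image-∈ g∈) (leaf-∈ h∈ l) on
... | inj₁ eq        = inj₁ (==⇒≡ eq)
... | inj₂ (inj₁ eq) = inj₂ (inj₁ (==⇒≡ eq))
... | inj₂ (inj₂ eq) = inj₂ (inj₂ (==⇒≡ eq))

lineOf-injective : ∀ {f g} → f ∈ X3 → g ∈ X3 → lineOf f ≡ lineOf g → f ≡ g
lineOf-injective {f} f∈ g∈ eq = ==⇒≡ (injective-claim (image-∈ f∈) (image-∈ g∈)
  (subst (λ cd → T (eqV (proj₁ (lineOf f)) (proj₁ cd) ∧ eqV (proj₂ (lineOf f)) (proj₂ cd))) eq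
    (Equivalence.from T-∧ (eqV-refl (proj₁ (lineOf f)) , eqV-refl (proj₂ (lineOf f))))))

isH2Line⇒isQPoint : ∀ {a b} → T (isH2Line a b) → T (isQPoint a)
isH2Line⇒isQPoint {a} h = proj₁ (Equivalence.to (T-∧ {isQPoint a}) h)

lineOf-surjective : ∀ {a b} → T (isH2Line a b) → ∃ λ f → f ∈ X3 × lineOf f ≡ (a , b)
lineOf-surjective {a} {b} h with surjective-claim (∈-vectors a) (isH2Line⇒isQPoint {a} {b} h) (∈-vectors b) h
... | s , s∈ , eq with images-∈⁻ s∈
... | f , f∈ , refl with Equivalence.to (T-∧ {eqV a (proj₁ (lineOf f))}) eq
... | ea , eb = f , f∈ , sym (cong₂ _,_ (eqV⇒≡ ea) (eqV⇒≡ eb))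

coords-surjective : ∀ {x} → T (isQPoint x) → ∃₂ λ f i → f ∈ X3 × T (0 <ᵇ at f i) ×
  (∀ {g} → g ∈ X3 → T (link X3 f g) → T (at g i <ᵇ at f i) → x ≡ coords f g)
coords-surjective {x} h with covering-claim (∈-vectors x) h
... | s , s∈ , _ , i , pos , closer with stars-∈⁻ s∈
... | f , f∈ , refl = f , i , f∈ , pos , λ g∈ l lt → eqV⇒≡ (closer (leaf-∈ g∈ l) lt)

-- Near hexagons of order (2,2)

thirdIndex : ∀ (i j : Fin 3) → i ≢ j → ∃ λ k → k ≢ i × k ≢ j × (∀ m → m ≡ i ⊎ m ≡ j ⊎ m ≡ k)
thirdIndex = from-yes (Fin.all? λ (i : Fin 3) → Fin.all? λ (j : Fin 3) → ¬? (i Fin.≟ j) →-dec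
  Fin.any? λ (k : Fin 3) → ¬? (k Fin.≟ i) ×-dec ¬? (k Fin.≟ j) ×-dec
  Fin.all? λ (m : Fin 3) → (m Fin.≟ i) ⊎-dec (m Fin.≟ j) ⊎-dec (m Fin.≟ k))

data Pattern : ℕ → ℕ → ℕ → Set where
  first  : ∀ {k} → Pattern k (suc k) (suc k)
  second : ∀ {k} → Pattern (suc k) k (suc k)
  last   : ∀ {k} → Pattern (suc k) (suc k) k

module NearHexagon (N : Geom) (nh : IsNearHexagon N) (ord : HasOrder N 2 2) where

  infix 4 _∈ˡ_ _~_
  _∈ˡ_ : Pt N → Ln N → Set
  p ∈ˡ K = T (inc N p K)

  _~_ : Pt N → Pt N → Set
  _~_ = Collinear N

  line-unique : ∀ {p q K M} → p ≢ q → p ∈ˡ K → q ∈ˡ K → p ∈ˡ M → q ∈ˡ M → K ≡ M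
  line-unique = proj₂ (proj₁ nh) _ _ _ _

  pointOn : Ln N → Fin 3 → Pt N
  pointOn K m = proj₁ (Bijection.to (proj₁ ord K) m)

  pointOn-∈ : ∀ K m → pointOn K m ∈ˡ K
  pointOn-∈ K m = proj₂ (Bijection.to (proj₁ ord K) m)

  Σ-≡ : ∀ {A : Set} {P : A → Bool} {x y : Σ A (T ∘ P)} → proj₁ x ≡ proj₁ y → x ≡ y
  Σ-≡ {P = P} {x , p} {.x , q} refl = cong (x ,_) (T-irrelevant {P x} p q)

  pointOn-injective : ∀ K {m n} → pointOn K m ≡ pointOn K n → m ≡ n
  pointOn-injective K eq = Bijection.injective (proj₁ ord K) (Σ-≡ {P = λ p → inc N p K} eq)

  pointOn-surjective : ∀ {K p} → p ∈ˡ K → ∃ λ m → pointOn K m ≡ p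
  pointOn-surjective {K} p∈K with Bijection.surjective (proj₁ ord K) (_ , p∈K)
  ... | m , eq = m , cong proj₁ (eq refl)

  lineAt : Pt N → Fin 3 → Ln N
  lineAt p m = proj₁ (Bijection.to (proj₂ ord p) m)

  lineAt-∋ : ∀ p m → p ∈ˡ lineAt p m
  lineAt-∋ p m = proj₂ (Bijection.to (proj₂ ord p) m)

  lineAt-injective : ∀ p {m n} → lineAt p m ≡ lineAt p n → m ≡ n
  lineAt-injective p eq = Bijection.injective (proj₂ ord p) (Σ-≡ {P = inc N p} eq)

  lineAt-surjective : ∀ {K p} → p ∈ˡ K → ∃ λ m → lineAt p m ≡ K
  lineAt-surjective {p = p} p∈K with Bijection.surjective (proj₂ ord p) (_ , p∈K)
  ... | m , eq = m , cong proj₁ (eq refl)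

  ~-sym : ∀ {x y} → x ~ y → y ~ x
  ~-sym (x≢y , K , p , q) = x≢y ∘ sym , K , q , p

  Within-cons : ∀ k {x y z} → x ~ y → Within N k y z → Within N (suc k) x z
  Within-cons zero    x~y refl                 = inj₂ (_ , refl , x~y)
  Within-cons (suc k) x~y (inj₁ w)             = inj₁ (Within-cons k x~y w)
  Within-cons (suc k) x~y (inj₂ (v , w , v~z)) = inj₂ (v , Within-cons k x~y w , v~z)

  Within-sym : ∀ k {x y} → Within N k x y → Within N k y x
  Within-sym zero    eq                   = sym eq
  Within-sym (suc k) (inj₁ w)             = inj₁ (Within-sym k w)
  Within-sym (suc k) (inj₂ (z , w , z~y)) = Within-cons k (~-sym z~y) (Within-sym k w)

  Within-mono : ∀ {k l x y} → k ≤ l → Within N k x y → Within N l x y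
  Within-mono {zero}  {zero}  _ w = w
  Within-mono {zero}  {suc l} _ w = inj₁ (Within-mono {zero} {l} z≤n w)
  Within-mono {suc k} {suc l} (s≤s k≤l) (inj₁ w)             = inj₁ (Within-mono k≤l w)
  Within-mono {suc k} {suc l} (s≤s k≤l) (inj₂ (z , w , z~y)) = inj₂ (z , Within-mono k≤l w , z~y)

  Dist⇒Within : ∀ {x y} k → Dist N x y k → Within N k x y
  Dist⇒Within zero    eq = eq
  Dist⇒Within (suc k) d  = proj₁ d

  Dist-minimal : ∀ {x y} k {l} → Dist N x y k → Within N l x y → k ≤ l
  Dist-minimal zero    _ _ = z≤n
  Dist-minimal (suc k) {l} (_ , ¬w) w with suc k ≤? l
  ... | yes k<l = k<l
  ... | no  k≮l = contradiction (Within-mono (≤-pred (≰⇒> k≮l)) w) ¬w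

  opaque
    -- Equality of points is not given as decidable. The nearest point to x on a line through y
    -- comes with its distance, and whether it is y is decided by comparing indices on that line.
    dist-exists : ∀ x y → ∃ (Dist N x y)
    dist-exists x y with proj₂ (proj₂ nh) x (lineAt y zero)
    ... | p , p∈K , k , dxp , far
      with pointOn-surjective p∈K | pointOn-surjective (lineAt-∋ y zero)
    ... | m , refl | n , eq with m Fin.≟ n
    ... | yes refl = k , subst (λ q → Dist N x q k) eq dxp
    ... | no  m≢n  = suc k , inj₂ (_ , Dist⇒Within k dxp , p≢y , _ , p∈K , lineAt-∋ y zero)
                           , far y (lineAt-∋ y zero) (p≢y ∘ sym)
      where p≢y : pointOn (lineAt y zero) m ≢ y
            p≢y p≡y = m≢n (pointOn-injective _ (trans p≡y (sym eq)))

  d : Pt N → Pt N → ℕ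
  d x y = proj₁ (dist-exists x y)

  d-Dist : ∀ x y → Dist N x y (d x y)
  d-Dist x y = proj₂ (dist-exists x y)

  d-Within : ∀ x y → Within N (d x y) x y
  d-Within x y = Dist⇒Within (d x y) (d-Dist x y)

  Within⇒d≤ : ∀ {k x y} → Within N k x y → d x y ≤ k
  Within⇒d≤ {k} {x} {y} = Dist-minimal (d x y) (d-Dist x y)

  Dist⇒d≡ : ∀ {x y k} → Dist N x y k → d x y ≡ k
  Dist⇒d≡ {x} {y} {k} p = ≤-antisym (Within⇒d≤ (Dist⇒Within k p)) (Dist-minimal k p (d-Within x y))

  d-sym : ∀ x y → d x y ≡ d y x
  d-sym x y = ≤-antisym (Within⇒d≤ (Within-sym (d y x) (d-Within y x)))
                        (Within⇒d≤ (Within-sym (d x y) (d-Within x y)))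

  d≤3 : ∀ x y → d x y ≤ 3
  d≤3 x y = Within⇒d≤ (proj₁ (proj₁ (proj₂ nh)) x y)

  d≡0⇒≡ : ∀ {x y} → d x y ≡ 0 → x ≡ y
  d≡0⇒≡ {x} {y} eq = subst (λ k → Dist N x y k) eq (d-Dist x y)

  d-refl : ∀ x → d x x ≡ 0
  d-refl x = Dist⇒d≡ {k = 0} refl

  opaque
    _≟ᵖ_ : DecidableEquality (Pt N)
    x ≟ᵖ y with d x y in eq
    ... | zero  = yes (d≡0⇒≡ eq)
    ... | suc _ = no λ { refl → contradiction (trans (sym eq) (d-refl x)) λ () }

  ~⇒d≡1 : ∀ {x y} → x ~ y → d x y ≡ 1
  ~⇒d≡1 x~y = Dist⇒d≡ {k = 1} (inj₂ (_ , refl , x~y) , proj₁ x~y)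

  opaque
    step-towards : ∀ {x y k} → d x y ≡ suc k → ∃ λ z → y ~ z × d x z ≡ k
    step-towards {x} {y} {k} eq with subst (Dist N x y) eq (d-Dist x y)
    ... | inj₁ w , ¬w = contradiction w ¬w
    ... | inj₂ (z , w , z~y) , ¬w = z , ~-sym z~y , ≤-antisym (Within⇒d≤ {k} w) (≤-pred k<)
      where k< : suc k ≤ suc (d x z)
            k< = subst (_≤ _) eq (Within⇒d≤ {suc (d x z)} (inj₂ (z , d-Within x z , z~y)))

  d≡1⇒~ : ∀ {x y} → d x y ≡ 1 → x ~ y
  d≡1⇒~ eq with step-towards eq
  ... | z , y~z , d≡0 with refl ← d≡0⇒≡ d≡0 = ~-sym y~z

  opaque
    nearest-on : ∀ x K → ∃ λ p → p ∈ˡ K × (∀ {q} → q ∈ˡ K → q ≢ p → d x q ≡ suc (d x p))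
    nearest-on x K with proj₂ (proj₂ nh) x K
    ... | p , p∈K , k , dxp , far = p , p∈K , λ {q} q∈K q≢p → trans
            (Dist⇒d≡ {k = suc k} (inj₂ (p , Dist⇒Within k dxp , q≢p ∘ sym , K , p∈K , q∈K) , far q q∈K q≢p))
            (cong suc (sym (Dist⇒d≡ dxp)))

  record Triple (K : Ln N) (u v w : Pt N) : Set where
    constructor triple
    field
      u∈ : u ∈ˡ K
      v∈ : v ∈ˡ K
      w∈ : w ∈ˡ K
      u≢v : u ≢ v
      u≢w : u ≢ w
      v≢w : v ≢ w
      exhaust : ∀ {q} → q ∈ˡ K → q ≡ u ⊎ q ≡ v ⊎ q ≡ w

  opaque
    thirdPoint : ∀ {K u v} → u ∈ˡ K → v ∈ˡ K → u ≢ v → ∃ (Triple K u v)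
    thirdPoint {K} u∈K v∈K u≢v with pointOn-surjective u∈K | pointOn-surjective v∈K
    ... | i , refl | j , refl with thirdIndex i j (u≢v ∘ cong (pointOn K))
    ... | k , k≢i , k≢j , cover = pointOn K k , triple u∈K v∈K (pointOn-∈ K k) u≢v
            (λ eq → k≢i (sym (pointOn-injective K eq))) (λ eq → k≢j (sym (pointOn-injective K eq))) ex
      where
      ex : ∀ {q} → q ∈ˡ K → q ≡ pointOn K i ⊎ q ≡ pointOn K j ⊎ q ≡ pointOn K k
      ex q∈K with pointOn-surjective q∈K
      ... | m , refl with cover m
      ... | inj₁ refl        = inj₁ refl
      ... | inj₂ (inj₁ refl) = inj₂ (inj₁ refl)
      ... | inj₂ (inj₂ refl) = inj₂ (inj₂ refl)

  opaque
    Triple-exhaust : ∀ {K u v w} → u ∈ˡ K → v ∈ˡ K → w ∈ˡ K → u ≢ v → u ≢ w → v ≢ w → Triple K u v w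
    Triple-exhaust u∈ v∈ w∈ u≢v u≢w v≢w with thirdPoint u∈ v∈ u≢v
    ... | w′ , T′ with Triple.exhaust T′ w∈
    ... | inj₁ eq        = contradiction (sym eq) u≢w
    ... | inj₂ (inj₁ eq) = contradiction (sym eq) v≢w
    ... | inj₂ (inj₂ refl) = T′

  opaque
    distances : ∀ {K u v w} → Triple K u v w → ∀ x → Pattern (d x u) (d x v) (d x w)
    distances {K} (triple u∈ v∈ w∈ u≢v u≢w v≢w ex) x with nearest-on x K
    ... | p , p∈K , far with ex p∈K
    ... | inj₁ refl rewrite far v∈ (u≢v ∘ sym) | far w∈ (u≢w ∘ sym) = first
    ... | inj₂ (inj₁ refl) rewrite far u∈ u≢v | far w∈ (v≢w ∘ sym) = second
    ... | inj₂ (inj₂ refl) rewrite far u∈ u≢w | far v∈ v≢w = last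

  -- The counterpart of `onLine` for points: if u and v are collinear, v′ is one of the two points
  -- other than u on their line.
  Aligned : Pt N → Pt N → Pt N → Set
  Aligned u v v′ = v′ ≡ v ⊎ ∃ λ K → Triple K u v v′

  opaque
    four-neighbours : ∀ {u} (v : Fin 4 → Pt N) → (∀ m → u ~ v m) →
      ∃₂ λ m n → m <ᶠ n × Aligned u (v m) (v n)
    four-neighbours {u} v u~ =
      let m , n , m<n , eq = Fin.pigeonhole (≤-refl {4}) (proj₁ ∘ index) in m , n , m<n , aligned m n eq
      where
      K : Fin 4 → Ln N
      K m = proj₁ (proj₂ (u~ m))
      u∈K : ∀ m → u ∈ˡ K m
      u∈K m = proj₁ (proj₂ (proj₂ (u~ m)))
      v∈K : ∀ m → v m ∈ˡ K m
      v∈K m = proj₂ (proj₂ (proj₂ (u~ m)))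
      index : ∀ m → ∃ λ l → lineAt u l ≡ K m
      index m = lineAt-surjective (u∈K m)
      aligned : ∀ m n → proj₁ (index m) ≡ proj₁ (index n) → Aligned u (v m) (v n)
      aligned m n eq with v n ≟ᵖ v m
      ... | yes vn≡vm = inj₁ vn≡vm
      ... | no  vn≢vm = inj₂ (K m , Triple-exhaust (u∈K m) (v∈K m) (subst (v n ∈ˡ_) Kn≡Km (v∈K n))
                                (proj₁ (u~ m)) (proj₁ (u~ n)) (vn≢vm ∘ sym))
        where
        Kn≡Km : K n ≡ K m
        Kn≡Km = trans (sym (proj₂ (index n))) (trans (cong (lineAt u) (sym eq)) (proj₂ (index m)))

  opaque
    four-cases : ∀ {u a b c e} → u ~ a → u ~ b → u ~ c → u ~ e →
      Aligned u a b ⊎ Aligned u a c ⊎ Aligned u a e ⊎ Aligned u b c ⊎ Aligned u b e ⊎ Aligned u c e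
    four-cases {u} {a} {b} {c} {e} ua ub uc ue with four-neighbours v u~v
      where
      v : Fin 4 → Pt N
      v = lookup (a ∷ b ∷ c ∷ e ∷ [])
      u~v : ∀ m → u ~ v m
      u~v zero                   = ua
      u~v (suc zero)             = ub
      u~v (suc (suc zero))       = uc
      u~v (suc (suc (suc zero))) = ue
    ... | zero , suc zero , _ , al = inj₁ al
    ... | zero , suc (suc zero) , _ , al = inj₂ (inj₁ al)
    ... | zero , suc (suc (suc zero)) , _ , al = inj₂ (inj₂ (inj₁ al))
    ... | suc zero , suc (suc zero) , _ , al = inj₂ (inj₂ (inj₂ (inj₁ al)))
    ... | suc zero , suc (suc (suc zero)) , _ , al = inj₂ (inj₂ (inj₂ (inj₂ (inj₁ al))))
    ... | suc (suc zero) , suc (suc (suc zero)) , _ , al = inj₂ (inj₂ (inj₂ (inj₂ (inj₂ al))))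
    ... | suc _ , suc zero , s≤s () , _
    ... | suc (suc _) , suc (suc zero) , s≤s (s≤s ()) , _
    ... | suc (suc (suc _)) , suc (suc (suc zero)) , s≤s (s≤s (s≤s ())) , _

  opaque
    otherPoint : ∀ {p K} → p ∈ˡ K → ∃ λ q → q ∈ˡ K × p ≢ q
    otherPoint {p} {K} p∈K with proj₁ (proj₁ nh) K
    ... | a , b , a≢b , a∈K , b∈K with a ≟ᵖ p
    ... | yes refl = b , b∈K , a≢b
    ... | no  a≢p  = a , a∈K , a≢p ∘ sym

-- Distances to the subhexagon

third₁-irrefl : ∀ k → third₁ k k ≡ pred k
third₁-irrefl zero    = refl
third₁-irrefl (suc k) with suc k ≡ᵇ suc k | ≡⇒≡ᵇ (suc k) (suc k) refl
... | true | _ = refl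

k≢ᵇ1+k : ∀ k → (k ≡ᵇ suc k) ≡ false
k≢ᵇ1+k zero    = refl
k≢ᵇ1+k (suc k) = k≢ᵇ1+k k

1+k≢ᵇk : ∀ k → (suc k ≡ᵇ k) ≡ false
1+k≢ᵇk zero    = refl
1+k≢ᵇk (suc k) = 1+k≢ᵇk k

Pattern⇒third₁ : ∀ {a b c} → Pattern a b c → third₁ a b ≡ c
Pattern⇒third₁ (first {k})  rewrite k≢ᵇ1+k k = m≤n⇒m⊔n≡n (n≤1+n k)
Pattern⇒third₁ (second {k}) rewrite 1+k≢ᵇk k = m≥n⇒m⊔n≡m (n≤1+n k)
Pattern⇒third₁ (last {k})   = third₁-irrefl (suc k)

Pattern⇒close : ∀ {a b c} → Pattern a b c → a ≤ suc b × b ≤ suc a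
Pattern⇒close (first {k})  = m≤n⇒m≤1+n (n≤1+n k) , ≤-refl
Pattern⇒close (second {k}) = ≤-refl , m≤n⇒m≤1+n (n≤1+n k)
Pattern⇒close (last {k})   = n≤1+n _ , n≤1+n _

nearest-refl : ∀ k → T (nearest k (suc k) (suc k))
nearest-refl k = Equivalence.from T-∧ (≡⇒≡ᵇ k k refl , ≡⇒≡ᵇ k k refl)

Pattern⇒lineOK : ∀ {a b c} → Pattern a b c → T (lineOK a b c)
Pattern⇒lineOK (first {k})  = Equivalence.from T-∨ (inj₁ (nearest-refl k))
Pattern⇒lineOK (second {k}) = Equivalence.from (T-∨ {nearest (suc k) k (suc k)})
  (inj₂ (Equivalence.from T-∨ (inj₁ (nearest-refl k))))
Pattern⇒lineOK (last {k})   = Equivalence.from (T-∨ {nearest (suc k) (suc k) k})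
  (inj₂ (Equivalence.from (T-∨ {nearest (suc k) (suc k) k}) (inj₂ (nearest-refl k))))

Patterns⇒third : ∀ {n} (a b c : Vec ℕ n) → (∀ i → Pattern (lookup a i) (lookup b i) (lookup c i)) → third a b ≡ c
Patterns⇒third []       []       []       h = refl
Patterns⇒third (_ ∷ as) (_ ∷ bs) (_ ∷ cs) h = cong₂ _∷_ (Pattern⇒third₁ (h zero)) (Patterns⇒third as bs cs (h ∘ suc))

Patterns⇒close : ∀ {n} (a b c : Vec ℕ n) → (∀ i → Pattern (lookup a i) (lookup b i) (lookup c i)) → T (close a b)
Patterns⇒close []       []       []       h = tt
Patterns⇒close (x ∷ as) (y ∷ bs) (_ ∷ cs) h = Equivalence.from (T-∧ {x ≤ᵇ suc y}) (≤⇒≤ᵇ (proj₁ (Pattern⇒close (h zero))) ,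
  Equivalence.from (T-∧ {y ≤ᵇ suc x}) (≤⇒≤ᵇ (proj₂ (Pattern⇒close (h zero))) , Patterns⇒close as bs cs (h ∘ suc)))

≡ᶠ⇒≡ : ∀ p q → T (p ≡ᶠ q) → p ≡ q
≡ᶠ⇒≡ p q h = Fin.toℕ-injective (≡ᵇ⇒≡ (toℕ p) (toℕ q) h)

Meet : Pt H21 → Pt H21 → Set
Meet x y = proj₁ (proj₁ x) ≡ proj₁ (proj₁ y) ⊎ proj₂ (proj₁ x) ≡ proj₂ (proj₁ y)

meet : ∀ x y m → T (inc H21 x m) → T (inc H21 y m) → Meet x y
meet x y (inj₁ q) hx hy = inj₁ (trans (≡ᶠ⇒≡ _ q hx) (sym (≡ᶠ⇒≡ _ q hy)))
meet x y (inj₂ m) hx hy = inj₂ (trans (≡ᶠ⇒≡ _ m hx) (sym (≡ᶠ⇒≡ _ m hy)))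

Meet²⇒near : ∀ x z y → Meet x z → Meet z y → T (near x y)
Meet²⇒near ((p , l) , f) ((r , n) , g) ((q , m) , h) (inj₁ refl) (inj₁ refl) =
  Equivalence.from (T-∨ {fanoInc p m}) (inj₁ h)
Meet²⇒near ((p , l) , f) ((r , n) , g) ((q , m) , h) (inj₁ refl) (inj₂ refl) =
  Equivalence.from (T-∨ {fanoInc p m}) (inj₁ g)
Meet²⇒near ((p , l) , f) ((r , n) , g) ((q , m) , h) (inj₂ refl) (inj₁ refl) =
  Equivalence.from (T-∨ {fanoInc p m}) (inj₂ g)
Meet²⇒near ((p , l) , f) ((r , n) , g) ((q , m) , h) (inj₂ refl) (inj₂ refl) =
  Equivalence.from (T-∨ {fanoInc p m}) (inj₁ f)

module Embedding (N : Geom) (nh : IsNearHexagon N) (ord : HasOrder N 2 2)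
  (P : Pt N → Bool) (L : Ln N → Bool) (iso : Sub N P L ≅ H21) (metric : IsometricSub N P L) where

  open NearHexagon N nh ord

  private S = Sub N P L

  toPt : Pt S → Pt H21
  toPt = Bijection.to (_≅_.ptBij iso)

  toLn : Ln S → Ln H21
  toLn = Bijection.to (_≅_.lnBij iso)

  opaque
    σ : Ix → Pt S
    σ i = proj₁ (Bijection.surjective (_≅_.ptBij iso) (lookup flags i))

    toPt-σ : ∀ i → toPt (σ i) ≡ lookup flags i
    toPt-σ i = proj₂ (Bijection.surjective (_≅_.ptBij iso) (lookup flags i)) refl

  s : Ix → Pt N
  s i = proj₁ (σ i)

  τ : Ln H21 → Ln S
  τ m = proj₁ (Bijection.surjective (_≅_.lnBij iso) m)

  toLn-τ : ∀ m → toLn (τ m) ≡ m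
  toLn-τ m = proj₂ (Bijection.surjective (_≅_.lnBij iso) m) refl

  ℓ : Ln H21 → Ln N
  ℓ m = proj₁ (τ m)

  opaque
    s-∈ : ∀ i m → T (inc H21 (lookup flags i) m) → s i ∈ˡ ℓ m
    s-∈ i m h = subst T (sym (trans (_≅_.pres iso (σ i) (τ m)) (cong₂ (inc H21) (toPt-σ i) (toLn-τ m)))) h

  opaque
    s-≢ : ∀ {i j} → T (differ i j) → s i ≢ s j
    s-≢ {i} {j} h eq = T-not h (subst (λ f → T ((point i ≡ᶠ proj₁ (proj₁ f)) ∧ (line i ≡ᶠ proj₂ (proj₁ f)))) flag-eq
        (Equivalence.from (T-∧ {point i ≡ᶠ point i}) (≡⇒≡ᵇ (toℕ (point i)) _ refl , ≡⇒≡ᵇ (toℕ (line i)) _ refl)))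
      where
      flag-eq : lookup flags i ≡ lookup flags j
      flag-eq = trans (sym (toPt-σ i)) (trans (cong toPt (Σ-≡ {P = P} eq)) (toPt-σ j))

  Collinear⇒Meet : ∀ {x y} → Collinear S x y → Meet (toPt x) (toPt y)
  Collinear⇒Meet {x} {y} (_ , M , hx , hy) = meet (toPt x) (toPt y) (toLn M)
    (subst T (_≅_.pres iso x M) hx) (subst T (_≅_.pres iso y M) hy)

  Within1⇒Meet : ∀ {x y} → Within S 1 x y → Meet (toPt x) (toPt y)
  Within1⇒Meet (inj₁ refl)           = inj₁ refl
  Within1⇒Meet (inj₂ (_ , refl , c)) = Collinear⇒Meet c

  Within2⇒near : ∀ {x y} → Within S 2 x y → T (near (toPt x) (toPt y))
  Within2⇒near {x} {y} (inj₁ w)           = Meet²⇒near (toPt x) (toPt x) (toPt y) (inj₁ refl) (Within1⇒Meet w)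
  Within2⇒near {x} {y} (inj₂ (z , w , c)) = Meet²⇒near (toPt x) (toPt z) (toPt y) (Within1⇒Meet w) (Collinear⇒Meet c)

  Dist⇒Within2 : ∀ {x y} k → k ≤ 2 → Dist S x y k → Within S 2 x y
  Dist⇒Within2 0 _ eq = inj₁ (inj₁ eq)
  Dist⇒Within2 1 _ d₁ = inj₁ (proj₁ d₁)
  Dist⇒Within2 2 _ d₂ = proj₁ d₂
  Dist⇒Within2 (suc (suc (suc _))) (s≤s (s≤s ())) _

  opaque
    -- This is where isometry enters: a short path in N is replaced by one in S, and paths in S can
    -- be read off from the flags.
    d≤2⇒near2 : ∀ i j → d (s i) (s j) ≤ 2 → T (near2 i j)
    d≤2⇒near2 i j le = subst T (cong₂ near (toPt-σ i) (toPt-σ j))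
      (Within2⇒near (Dist⇒Within2 (d (s i) (s j)) le (Equivalence.from (metric (σ i) (σ j) (d (s i) (s j))) (d-Dist (s i) (s j)))))

  opaque
    F : Pt N → Val
    F u = tabulate λ i → d u (s i)

    at-F : ∀ u i → at (F u) i ≡ d u (s i)
    at-F u = lookup∘tabulate (λ i → d u (s i))

  at-F′ : ∀ u i → at (F u) i ≡ d (s i) u
  at-F′ u i = trans (at-F u i) (d-sym u (s i))

  F-pattern : ∀ {K u v w} → Triple K u v w → ∀ i → Pattern (at (F u) i) (at (F v) i) (at (F w) i)
  F-pattern {u = u} {v} {w} t i rewrite at-F′ u i | at-F′ v i | at-F′ w i = distances t (s i)

  opaque
    F-third : ∀ {K u v w} → Triple K u v w → third (F u) (F v) ≡ F w
    F-third t = Patterns⇒third _ _ _ (F-pattern t)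

  opaque
    F-link : ∀ {X} → (∀ u → F u ∈ X) → ∀ {u v} → u ~ v → T (link X (F u) (F v))
    F-link {X} F∈X {u} {v} (u≢v , K , u∈K , v∈K) with thirdPoint u∈K v∈K u≢v
    ... | w , t = link⁺ (Patterns⇒close (F u) (F v) (F w) (F-pattern t)) (subst (_∈ X) (sym (F-third t)) (F∈X w))

  zero⇒s : ∀ {u i} → T (at (F u) i ≡ᵇ 0) → u ≡ s i
  zero⇒s {u} {i} h = d≡0⇒≡ (trans (sym (at-F u i)) (≡ᵇ⇒≡ _ 0 h))

  at-s : ∀ i → at (F (s i)) i ≡ 0
  at-s i = trans (at-F (s i) i) (d-refl (s i))

  one⇒~ : ∀ {u i} → T (at (F u) i ≡ᵇ 1) → s i ~ u
  one⇒~ {u} {i} h = d≡1⇒~ (trans (sym (at-F′ u i)) (≡ᵇ⇒≡ _ 1 h))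

  ~⇒one : ∀ {u i} → s i ~ u → T (at (F u) i ≡ᵇ 1)
  ~⇒one {u} {i} c = ≡⇒≡ᵇ _ 1 (trans (at-F′ u i) (~⇒d≡1 c))

  opaque
    F-isometric : ∀ u → T (isometric (F u))
    F-isometric u = all-from _ (allFin 21) λ {i} _ → helper i
      where
      far : ∀ i j → u ≡ s i → T (near2 i j ∨ (at (F u) j ≡ᵇ 3))
      far i j refl with d (s i) (s j) ≤? 2
      ... | yes le = Equivalence.from T-∨ (inj₁ (d≤2⇒near2 i j le))
      ... | no ¬le = Equivalence.from (T-∨ {near2 i j}) (inj₂ (≡⇒≡ᵇ _ 3
                       (trans (at-F (s i) j) (≤-antisym (d≤3 _ _) (≰⇒> ¬le)))))
      helper : ∀ i → T (not (at (F u) i ≡ᵇ 0) ∨ all (λ j → near2 i j ∨ (at (F u) j ≡ᵇ 3)) (allFin 21))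
      helper i with at (F u) i ≡ᵇ 0 in eq
      ... | false = tt
      ... | true  = all-from _ (allFin 21) λ {j} _ → far i j (zero⇒s {u} {i} (subst T (sym eq) tt))

  opaque
    F-onLines : ∀ u → OnLines steps (F u)
    F-onLines u {i} {j} {k} t∈ =
      let ij , ik , jk , m , _ , hi , hj , hk = lines-claim t∈
          t = Triple-exhaust (s-∈ i m hi) (s-∈ j m hj) (s-∈ k m hk) (s-≢ {i} {j} ij) (s-≢ {i} {k} ik) (s-≢ {j} {k} jk)
      in Pattern⇒lineOK (subst (λ a → Pattern a (at (F u) j) (at (F u) k)) (sym (at-F u i))
           (subst₂ (Pattern (d u (s i))) (sym (at-F u j)) (sym (at-F u k)) (distances t u)))

  opaque
    F∈X0 : ∀ u → F u ∈ X0
    F∈X0 u = X0⁺ (enumerate-complete steps (F u) (λ i → subst (_≤ 3) (sym (at-F u i)) (d≤3 u (s i))) (F-onLines u))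
                 (F-isometric u)

  Aligned⇒onLine : ∀ {u v v′} → Aligned u v v′ → T (onLine (F u) (F v) (F v′))
  Aligned⇒onLine (inj₁ v′≡v)   = onLine⁺ (inj₁ (cong F v′≡v))
  Aligned⇒onLine (inj₂ (_ , t)) = onLine⁺ (inj₂ (sym (F-third t)))

  opaque
    closer : ∀ {u i k} → at (F u) i ≡ suc k → ∃ λ v → u ~ v × at (F v) i ≡ k
    closer {u} {i} eq with step-towards {x = s i} {y = u} (trans (sym (at-F′ u i)) eq)
    ... | v , u~v , eq′ = v , u~v , trans (at-F′ v i) eq′

  opaque
    closer⁺ : ∀ {u i} → T (0 <ᵇ at (F u) i) → ∃ λ v → u ~ v × at (F v) i < at (F u) i
    closer⁺ {u} {i} pos with at (F u) i in eq
    ... | suc k with closer eq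
    ... | v , u~v , eq′ = v , u~v , subst (_< suc k) (sym eq′) (n<1+n k)

  opaque
    unblocked : ∀ {R X} → (∀ {u v} → u ~ v → T (R (F u) (F v))) → (∀ u → F u ∈ X) →
      ∀ k u c → ¬ ⟦ blocked R X k (F u) c ⟧
    unblocked R~ F∈X k u c (levels , apart) = clash (four-neighbours v u~v)
      where
      next : ∀ m → ∃ λ v → u ~ v × at (F v) (lookup c m) ≡ k
      next m = closer (≡ᵇ⇒≡ _ _ (levels m))
      v : Fin 4 → Pt N
      v m = proj₁ (next m)
      u~v : ∀ m → u ~ v m
      u~v m = proj₁ (proj₂ (next m))
      nearer : ∀ m → at (F (v m)) (lookup c m) < at (F u) (lookup c m)
      nearer m = subst₂ _<_ (sym (proj₂ (proj₂ (next m)))) (sym (≡ᵇ⇒≡ _ _ (levels m))) (n<1+n k)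
      clash : ¬ ∃₂ λ m n → m <ᶠ n × Aligned u (v m) (v n)
      clash (m , n , m<n , al) = apart (F∈X (v m)) (R~ (u~v m)) m n (<⇒<ᵇ m<n) (Equivalence.from T-∧
        ( onLine⇒covers {f = F u} {F (v m)} {F (v m)} (onLine⁺ {F u} (inj₁ refl)) (nearer m)
        , onLine⇒covers (Aligned⇒onLine al) (nearer n)))

  opaque
    F∈X1 : ∀ u → F u ∈ X1
    F∈X1 u with few-claim (F∈X0 u)
    ... | inj₁ few = X1⁺ (F∈X0 u) few
    ... | inj₂ bl  = ⊥-elim (unblocked {link X0} (F-link F∈X0) F∈X0 0 u (fourOf (level 1 (F u))) bl)

  opaque
    F-s : ∀ i → F (s i) ≡ row i
    F-s i = ==⇒≡ (rigid-claim (F∈X0 (s i)) i (≡⇒≡ᵇ _ 0 (at-s i)))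

  opaque
    classical⇒s : ∀ {u} → T (classical (F u)) → ∃ λ i → u ≡ s i
    classical⇒s h with classical⁻ h
    ... | i , hi = i , zero⇒s hi

  opaque
    F-s-injective : ∀ {u i} → F u ≡ F (s i) → u ≡ s i
    F-s-injective {u} {i} eq = zero⇒s (≡⇒≡ᵇ _ 0 (trans (cong (λ f → at f i) eq) (at-s i)))

  -- Neighbours of points of type B

  opaque
    B-escape : ∀ {u v a b} → u ~ s a → u ~ s b → u ~ v → ¬ T (onLine (F u) (F (s a)) (F (s b))) →
      ⟦ Claims.Bescape (F u) (F (s a)) (F (s b)) (F v) ⟧ → T (isB (F v) ∨ classical (F v))
    B-escape ua ub uv ¬ab (inj₁ ok) = ok
    -- The lines from u to `s a`, `s b` and v are distinct, hence all the lines through u, yet none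
    -- contains a point nearer to `s i` than u.
    B-escape ua ub uv ¬ab (inj₂ (¬av , ¬bv , i , pos , ¬ca , ¬cb , ¬cv)) with closer⁺ pos
    ... | z , uz , lt with four-cases ua ub uv uz
    ... | inj₁ al                             = contradiction (Aligned⇒onLine al) ¬ab
    ... | inj₂ (inj₁ al)                      = contradiction (Aligned⇒onLine al) ¬av
    ... | inj₂ (inj₂ (inj₁ al))               = contradiction (onLine⇒covers (Aligned⇒onLine al) lt) ¬ca
    ... | inj₂ (inj₂ (inj₂ (inj₁ al)))        = contradiction (Aligned⇒onLine al) ¬bv
    ... | inj₂ (inj₂ (inj₂ (inj₂ (inj₁ al)))) = contradiction (onLine⇒covers (Aligned⇒onLine al) lt) ¬cb
    ... | inj₂ (inj₂ (inj₂ (inj₂ (inj₂ al)))) = contradiction (onLine⇒covers (Aligned⇒onLine al) lt) ¬cv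

  opaque
    B-neighbour : ∀ {u v} → T (isB (F u)) → u ~ v → T (isB (F v) ∨ classical (F v))
    B-neighbour {u} {v} B uv =
      let a , b , ha , hb , apart , rest = Bneighbours-claim (F∈X1 u) B
      in B-escape (~-sym (one⇒~ ha)) (~-sym (one⇒~ hb)) uv
           (subst₂ (λ ra rb → ¬ T (onLine (F u) ra rb)) (sym (F-s a)) (sym (F-s b)) apart)
           (subst₂ (λ ra rb → ⟦ Claims.Bescape (F u) ra rb (F v) ⟧) (sym (F-s a)) (sym (F-s b))
             (rest (F∈X1 v) (F-link F∈X1 uv)))

  F-okB : ∀ {u v} → u ~ v → T (okB (F u) (F v))
  F-okB u~v = okB⁺ λ B → B-neighbour B u~v

  opaque
    F-linkB : ∀ {X} → (∀ u → F u ∈ X) → ∀ {u v} → u ~ v → T (linkB X (F u) (F v))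
    F-linkB F∈X {u} {v} u~v@(u≢v , K , u∈K , v∈K) with thirdPoint u∈K v∈K u≢v
    ... | w , t = linkB⁺ (F-link F∈X u~v) (F-okB u~v) (F-okB (~-sym u~v))
        (subst (λ f → T (okB f (F u))) (sym (F-third t)) (F-okB (Triple.u≢w t ∘ sym , K , Triple.w∈ t , u∈K)))

  opaque
    F∈X2 : ∀ u → F u ∈ X2
    F∈X2 u with ones-claim (F∈X1 u)
    ... | inj₁ has  = X2⁺ (F∈X1 u) has
    ... | inj₂ bl   = ⊥-elim (unblocked {linkB X1} (F-linkB F∈X1) F∈X1 1 u (fourOf (level 2 (F u))) bl)

  opaque
    onLine-s⇒∈ : ∀ {K u v i} → u ∈ˡ K → v ∈ˡ K → u ≢ v → T (onLine (F u) (F v) (F (s i))) → s i ∈ˡ K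
    onLine-s⇒∈ {K} u∈K v∈K u≢v on with onLine⁻ on | thirdPoint u∈K v∈K u≢v
    ... | inj₁ eq | _     = subst (_∈ˡ K) (F-s-injective (sym eq)) v∈K
    ... | inj₂ eq | w , t = subst (_∈ˡ K) (F-s-injective (trans (sym (F-third t)) (sym eq))) (Triple.w∈ t)

  -- Lines leaving the subhexagon

  Outside : Ix → Set
  Outside i = ∃ λ u → s i ~ u × ¬ T (classical (F u))

  opaque
    -- Choose a further point on each of the three lines through `s i`. If all three were in S, two
    -- of them would lie on one line with `s i`.
    outside : ∀ i → Outside i
    outside i = search (T? (classical (F (q (# 0))))) (T? (classical (F (q (# 1))))) (T? (classical (F (q (# 2)))))
      where
      K : Fin 3 → Ln N
      K = lineAt (s i)
      other : ∀ m → ∃ λ q → q ∈ˡ K m × s i ≢ q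
      other m = otherPoint (lineAt-∋ (s i) m)
      q : Fin 3 → Pt N
      q m = proj₁ (other m)
      q∈ : ∀ m → q m ∈ˡ K m
      q∈ m = proj₁ (proj₂ (other m))
      ≢q : ∀ m → s i ≢ q m
      ≢q m = proj₂ (proj₂ (other m))
      ~q : ∀ m → s i ~ q m
      ~q m = ≢q m , K m , lineAt-∋ (s i) m , q∈ m
      inLevel : ∀ {a m} → q m ≡ s a → a ∈ level 1 (row i)
      inLevel {a} {m} eq = level⁺
        (subst (λ f → T (at f a ≡ᵇ 1)) (F-s i) (~⇒one {s i} {a} (~-sym (subst (s i ~_) eq (~q m)))))
      coincide : ∀ {m n a b} → q m ≡ s a → q n ≡ s b → T (onLine (row i) (row a) (row b)) → m ≡ n
      coincide {m} {n} {a} {b} qm qn on = lineAt-injective (s i)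
        (line-unique (≢q n) (lineAt-∋ (s i) m)
          (subst (_∈ˡ K m) (sym qn) (onLine-s⇒∈ (lineAt-∋ (s i) m) (q∈ m) (≢q m)
            (subst₂ (λ f g → T (onLine f g (F (s b)))) (sym (F-s i)) (trans (sym (F-s a)) (cong F (sym qm)))
              (subst (T ∘ onLine (row i) (row a)) (sym (F-s b)) on))))
          (lineAt-∋ (s i) n) (q∈ n))
      Classical? : Fin 3 → Set
      Classical? m = Dec (T (classical (F (q m))))
      search : Classical? (# 0) → Classical? (# 1) → Classical? (# 2) → Outside i
      search (no ¬c) _ _ = q (# 0) , ~q (# 0) , ¬c
      search _ (no ¬c) _ = q (# 1) , ~q (# 1) , ¬c
      search _ _ (no ¬c) = q (# 2) , ~q (# 2) , ¬c
      search (yes c₀) (yes c₁) (yes c₂) with classical⇒s c₀ | classical⇒s c₁ | classical⇒s c₂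
      ... | a , qa | b , qb | c , qc with proj₁ (twoLines-claim i) (inLevel qa) (inLevel qb) (inLevel qc)
      ... | inj₁ on        = contradiction (coincide {# 0} {# 1} qa qb on) λ ()
      ... | inj₂ (inj₁ on) = contradiction (coincide {# 0} {# 2} qa qc on) λ ()
      ... | inj₂ (inj₂ on) = contradiction (coincide {# 1} {# 2} qb qc on) λ ()

  aligned-with-row : ∀ {i j w} → T (classical (row j)) → T (classical (third (row i) (row j))) →
    Aligned (s i) (s j) w → T (classical (F w))
  aligned-with-row {i} {j} c ct al with onLine⁻ (Aligned⇒onLine al)
  ... | inj₁ eq = subst (T ∘ classical) (sym (trans eq (F-s j))) c
  ... | inj₂ eq = subst (T ∘ classical) (sym (trans eq (cong₂ third (F-s i) (F-s j)))) ct

  opaque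
    -- Two of the three lines through `s i` consist of points of S, so u and v share the remaining
    -- one.
    outside-unique : ∀ {i u v} → s i ~ u → s i ~ v →
      ¬ T (classical (F u)) → ¬ T (classical (F v)) → Aligned (s i) u v
    outside-unique {i} {u} {v} iu iv ¬cu ¬cv with proj₂ (twoLines-claim i)
    ... | a , ha , b , hb , apart , ca , cta , cb , ctb with four-cases (to-s ha) (to-s hb) iu iv
      where
      to-s : ∀ {j} → T (at (row i) j ≡ᵇ 1) → s i ~ s j
      to-s {j} h = ~-sym (one⇒~ (subst (λ f → T (at f j ≡ᵇ 1)) (sym (F-s i)) h))
    ... | inj₁ al = contradiction (subst₂ (λ f g → T (onLine f g (row b))) (F-s i) (F-s a)
                      (subst (T ∘ onLine (F (s i)) (F (s a))) (F-s b) (Aligned⇒onLine al))) apart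
    ... | inj₂ (inj₁ al)                      = contradiction (aligned-with-row ca cta al) ¬cu
    ... | inj₂ (inj₂ (inj₁ al))               = contradiction (aligned-with-row ca cta al) ¬cv
    ... | inj₂ (inj₂ (inj₂ (inj₁ al)))        = contradiction (aligned-with-row cb ctb al) ¬cu
    ... | inj₂ (inj₂ (inj₂ (inj₂ (inj₁ al)))) = contradiction (aligned-with-row cb ctb al) ¬cv
    ... | inj₂ (inj₂ (inj₂ (inj₂ (inj₂ al)))) = al

  HasType : (Val → Bool) → Ix → Set
  HasType type i = ∃ λ u → s i ~ u × T (type (F u))

  opaque
    A-or-B : ∀ i → HasType isA i ⊎ HasType isB i
    A-or-B i with outside i
    ... | u , c , ¬cl with types-claim (F∈X2 u)
    ... | inj₁ cl        = contradiction cl ¬cl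
    ... | inj₂ (inj₁ hA) = inj₁ (u , c , hA)
    ... | inj₂ (inj₂ hB) = inj₂ (u , c , hB)

  opaque
    F-third-row : ∀ {K i u w} → Triple K (s i) u w → third (row i) (F u) ≡ F w
    F-third-row {i = i} {u} {w} t = subst (λ r → third r (F u) ≡ F w) (F-s i) (F-third t)

  opaque
    -- The next point on a shortest path from p to `s j` is adjacent to `s j`, and `Aneighbours`
    -- leaves only type A for it.
    A-approach : ∀ {i j p} → T (at (row i) j ≡ᵇ 3) → s i ~ p → T (isA (F p)) → at (F p) j ≡ 2 → HasType isA j
    A-approach {i} {j} {p} opp ip hA two with closer two
    ... | z , p~z , one with Aneighbours-claim (F∈X2 p) hA i (~⇒one ip) (F∈X2 z) (F-linkB F∈X2 p~z)
    ... | inj₁ hAz = z , one⇒~ (≡⇒≡ᵇ _ 1 one) , hAz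
    ... | inj₂ far = contradiction (≡⇒≡ᵇ _ 1 one) (far j opp)

  opaque
    -- Since `s j` has the maximal distance 3 from `s i`, one of the two other points on the line
    -- leaving S at `s i` has distance 2 from `s j`. Both are of type A, so `A-approach` applies to
    -- either.
    A-opposite : ∀ {i} → HasType isA i → ∀ j → T (at (row i) j ≡ᵇ 3) → HasType isA j
    A-opposite {i} (u , c@(i≢u , K , i∈K , u∈K) , hA) j opp with thirdPoint i∈K u∈K i≢u
    ... | w , t with subst (λ f → T (isA f) × ((j : Ix) → T (at (row i) j ≡ᵇ 3) → T (at (F u) j ≡ᵇ 2) ⊎ T (at f j ≡ᵇ 2)))
                       (F-third-row t) (Aopposite-claim (F∈X2 u) hA i (~⇒one c))
    ... | hAw , two with two j opp
    ... | inj₁ eq = A-approach opp c hA (≡ᵇ⇒≡ _ 2 eq)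
    ... | inj₂ eq = A-approach opp (Triple.u≢w t , K , i∈K , Triple.w∈ t) hAw (≡ᵇ⇒≡ _ 2 eq)

  opaque
    all-A : ∀ {i} → HasType isA i → ∀ k → HasType isA k
    all-A {i} A k with hop-claim i k
    ... | j , ij , jk = A-opposite (A-opposite A j ij) k jk

  A-not-B : ∀ {i} → HasType isA i → ¬ HasType isB i
  A-not-B {i} (u , iu , hA) (v , iv , hB) = AnotB-claim (F∈X2 u) hA i (~⇒one iu) (F∈X2 v)
    (subst (λ r → T (onLine r (F u) (F v))) (F-s i)
      (Aligned⇒onLine (outside-unique iu iv (isA⇒¬classical hA) (isB⇒¬classical hB)))) hB

  -- Exclusion of type B

  Realised : Val → Set
  Realised f = ∃ λ u → F u ≡ f

  opaque
    -- The members of the grids have to be valuations of actual points before `outside-unique` can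
    -- refute a clash.
    grow-realised : ∀ {fs} → (∀ {f} → f ∈ fs → Realised f) → ∀ {f} → f ∈ Claims.grow rows fs → Realised f
    grow-realised {fs} real f∈ with ∈-++⁻ fs f∈
    ... | inj₁ f∈fs = real f∈fs
    ... | inj₂ f∈new with find (∈-concatMap⁻ (λ h → map (λ a → third (lookup rows a) h) (level 1 h)) {xs = fs} f∈new)
    ... | h , h∈ , f∈map with real h∈ | ∈-map⁻ (λ a → third (lookup rows a) h) f∈map
    ... | u , refl | a , a∈ , refl with one⇒~ (level⁻ a∈)
    ... | i≢u , K , i∈K , u∈K with thirdPoint i∈K u∈K i≢u
    ... | w , t = w , sym (trans (cong (λ r → third r (F u)) (lookup-rows a)) (F-third-row t))

  grow²-realised : ∀ u {f} → f ∈ Claims.grow rows (Claims.grow rows (F u ∷ [])) → Realised f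
  grow²-realised u = grow-realised {Claims.grow rows (F u ∷ [])} (grow-realised {F u ∷ []} λ { (here refl) → u , refl })

  opaque
    no-B : ∀ u → ¬ T (isB (F u))
    no-B u B with centre-claim (Bs⁺ (F∈X2 u) B)
    ... | (a , ha) , z , _ , clash with A-or-B z
    -- Type A at the centre would spread to `s a`, whose neighbour u has type B.
    ... | inj₁ A = A-not-B (all-A A a) (u , one⇒~ ha , B)
    ... | inj₂ (v , zv , Bv) with clash (Bs⁺ (F∈X2 v) Bv) (~⇒one zv)
    ... | f , f∈ , g , g∈ , ¬cf , ¬cg , r , hf , hg , apart with grow²-realised u f∈ | grow²-realised v g∈
    ... | u′ , refl | v′ , refl = apart (subst (λ ρ → T (onLine ρ (F u′) (F v′))) (trans (F-s r) (sym (lookup-rows r)))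
            (Aligned⇒onLine (outside-unique (one⇒~ hf) (one⇒~ hg) ¬cf ¬cg)))

  opaque
    F∈X3 : ∀ u → F u ∈ X3
    F∈X3 u = X3⁺ (F∈X2 u) (no-B u)

  -- Points of N and the 63 valuations

  opaque
    -- Outside S, equal valuations give u and v a common neighbour in S, hence a common line leaving
    -- S, and on that line `pair` separates them.
    F-injective : ∀ {u v} → F u ≡ F v → u ≡ v
    F-injective {u} {v} eq with T? (classical (F u))
    ... | yes c with classical⇒s c
    ...   | i , refl = sym (F-s-injective (sym eq))
    F-injective {u} {v} eq | no ¬c with hasOne-claim (F∈X3 u) | pair-claim (F∈X3 u)
    ... | inj₁ c | _ = contradiction c ¬c
    ... | _ | inj₁ c = contradiction c ¬c
    ... | inj₂ (i , hi) | inj₂ pair with outside-unique (one⇒~ hi) (one⇒~ (subst (λ f → T (at f i ≡ᵇ 1)) eq hi))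
                                           ¬c (subst (λ f → ¬ T (classical f)) eq ¬c)
    ... | inj₁ v≡u     = sym v≡u
    ... | inj₂ (_ , t) = contradiction (≡⇒== (trans eq (sym (F-third-row t)))) (proj₁ (pair i hi))

  opaque
    -- A non-classical f has a neighbour `s i`. By `pair`, f is the valuation of one of the two
    -- points outside S on the line leaving S there, and that line exists by `outside`.
    X3-realised : ∀ {f} → f ∈ X3 → Realised f
    X3-realised {f} f∈ with T? (classical f)
    ... | yes c with classical⁻ c
    ...   | i , hi = s i , trans (F-s i) (sym (==⇒≡ (rigid-claim (X3⊆X0 f∈) i hi)))
    X3-realised {f} f∈ | no ¬c with hasOne-claim f∈
    ... | inj₁ c = contradiction c ¬c
    ... | inj₂ (i , hi) with outside i
    ... | u , iu@(i≢u , K , i∈K , u∈K) , ¬cu with pair-claim (F∈X3 u) | thirdPoint i∈K u∈K i≢u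
    ... | inj₁ c    | _ = contradiction c ¬cu
    ... | inj₂ pair | w , t with proj₂ (pair i (~⇒one iu)) f∈
    ... | inj₁ c  = contradiction c ¬c
    ... | inj₂ on with onLine⁻ (on hi)
    ... | inj₁ eq = u , sym eq
    ... | inj₂ eq = w , trans (sym (F-third-row t)) (sym eq)

  -- The isomorphism with the dual split Cayley hexagon

  coordsOf : Ln N → F2⁷
  coordsOf K = coords (F (pointOn K (# 0))) (F (pointOn K (# 1)))

  q₀≢q₁ : ∀ K → pointOn K (# 0) ≢ pointOn K (# 1)
  q₀≢q₁ K eq with pointOn-injective K eq
  ... | ()

  F-link₃ : ∀ {K u v} → u ∈ˡ K → v ∈ˡ K → u ≢ v → T (link X3 (F u) (F v))
  F-link₃ u∈K v∈K u≢v = F-link F∈X3 (u≢v , _ , u∈K , v∈K)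

  opaque
    coords-turn : ∀ {K u v w} → u ∈ˡ K → v ∈ˡ K → w ∈ˡ K → u ≢ v → u ≢ w →
      coords (F u) (F v) ≡ coords (F u) (F w)
    coords-turn {u = u} {v} {w} u∈K v∈K w∈K u≢v u≢w with v ≟ᵖ w
    ... | yes refl = refl
    ... | no  v≢w  = trans (coords-third (F∈X3 u) (F∈X3 v) (F-link₃ u∈K v∈K u≢v))
                           (cong (coords (F u)) (F-third (Triple-exhaust u∈K v∈K w∈K u≢v u≢w v≢w)))

  opaque
    coords-on : ∀ {K u v} → u ∈ˡ K → v ∈ˡ K → u ≢ v → coords (F u) (F v) ≡ coordsOf K
    coords-on {K} {u} u∈K v∈K u≢v with u ≟ᵖ pointOn K (# 0)
    ... | yes refl = coords-turn u∈K v∈K (pointOn-∈ K (# 1)) u≢v (q₀≢q₁ K)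
    ... | no  u≢q₀ = trans (coords-turn u∈K v∈K (pointOn-∈ K (# 0)) u≢v u≢q₀)
                    (trans (coords-sym (F∈X3 u) (F∈X3 _) (F-link₃ u∈K (pointOn-∈ K (# 0)) u≢q₀))
                           (coords-turn (pointOn-∈ K (# 0)) u∈K (pointOn-∈ K (# 1)) (u≢q₀ ∘ sym) (q₀≢q₁ K)))

  ∈⇒on : ∀ {K u} → u ∈ˡ K → T (coordsOf K on lineOf (F u))
  ∈⇒on {u = u} u∈K with otherPoint u∈K
  ... | v , v∈K , u≢v = subst (λ x → T (x on lineOf (F u))) (coords-on u∈K v∈K u≢v)
                          (coords-on-lineOf (F∈X3 u) (F∈X3 v) (F-link₃ u∈K v∈K u≢v))

  on⇒∈ : ∀ {K u} → T (coordsOf K on lineOf (F u)) → u ∈ˡ K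
  on⇒∈ {K} {u} on
    with on-lineOf-reflects (F∈X3 u) (F∈X3 _) (F∈X3 _) (F-link₃ (pointOn-∈ K (# 0)) (pointOn-∈ K (# 1)) (q₀≢q₁ K)) on
       | thirdPoint (pointOn-∈ K (# 0)) (pointOn-∈ K (# 1)) (q₀≢q₁ K)
  ... | inj₁ eq        | _     = subst (_∈ˡ K) (F-injective (sym eq)) (pointOn-∈ K (# 0))
  ... | inj₂ (inj₁ eq) | _     = subst (_∈ˡ K) (F-injective (sym eq)) (pointOn-∈ K (# 1))
  ... | inj₂ (inj₂ eq) | w , t = subst (_∈ˡ K) (F-injective (trans (sym (F-third t)) (sym eq))) (Triple.w∈ t)

  toH2Line : Pt N → Pt H2D
  toH2Line u = lineOf (F u) , lineOf-isH2Line (F∈X3 u)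

  toH2Point : Ln N → Ln H2D
  toH2Point K = coordsOf K , coords-isQPoint (F∈X3 _) (F∈X3 _) (F-link₃ (pointOn-∈ K (# 0)) (pointOn-∈ K (# 1)) (q₀≢q₁ K))

  toH2Line-surjective : ∀ m → ∃ λ u → ∀ {v} → v ≡ u → toH2Line v ≡ m
  toH2Line-surjective ((a , b) , h) with lineOf-surjective {a} {b} h
  ... | f , f∈ , eq with X3-realised f∈
  ... | u , refl = u , λ { refl → Σ-≡ {P = h2Line} eq }

  opaque
    -- By `∈⇒on` and `on⇒∈` the coordinates of a line determine which points lie on it.
    toH2Point-injective : ∀ {K M} → coordsOf K ≡ coordsOf M → K ≡ M
    toH2Point-injective {K} {M} eq = line-unique (q₀≢q₁ M) (M⊆K (# 0)) (M⊆K (# 1)) (pointOn-∈ M (# 0)) (pointOn-∈ M (# 1))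
      where
      M⊆K : ∀ m → pointOn M m ∈ˡ K
      M⊆K m = on⇒∈ (subst (λ x → T (x on lineOf (F (pointOn M m)))) (sym eq) (∈⇒on (pointOn-∈ M m)))

  toH2Point-surjective : ∀ x → ∃ λ K → ∀ {M} → M ≡ K → toH2Point M ≡ x
  toH2Point-surjective (x , h) with coords-surjective h
  ... | f , i , f∈ , pos , only with X3-realised f∈
  ... | u , refl with closer⁺ pos
  ... | z , u~z@(u≢z , K , u∈K , z∈K) , lt = K , λ { refl → Σ-≡ {P = isQPoint}
          (sym (trans (only (F∈X3 z) (F-link F∈X3 u~z) (<⇒<ᵇ lt)) (coords-on u∈K z∈K u≢z))) }

  T-ext : ∀ {a b} → (T a → T b) → (T b → T a) → a ≡ b
  T-ext {true}  {true}  _ _ = refl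
  T-ext {false} {false} _ _ = refl
  T-ext {true}  {false} f _ = ⊥-elim (f tt)
  T-ext {false} {true}  _ g = ⊥-elim (g tt)

  isomorphism : N ≅ H2D
  isomorphism = record
    { ptBij = mk⤖ ((λ {u} {v} eq → F-injective (lineOf-injective (F∈X3 u) (F∈X3 v) (cong proj₁ eq))) , toH2Line-surjective)
    ; lnBij = mk⤖ ((λ eq → toH2Point-injective (cong proj₁ eq)) , toH2Point-surjective)
    ; pres  = λ u K → T-ext {inc N u K} (∈⇒on {K} {u}) (on⇒∈ {K} {u})
    }

theorem1p1 : (N : Geom) → IsNearHexagon N → HasOrder N 2 2 →
    Σ (Pt N → Bool) (λ P → Σ (Ln N → Bool) (λ L →
    (Sub N P L ≅ H21) × IsometricSub N P L)) →
    N ≅ H2D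
theorem1p1 N nh ord (P , L , iso , metric) = Embedding.isomorphism N nh ord P L iso metric
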